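{- Let $c, m, n$ be nonnegative integers with $c\ge 1$ odd and $2\le m\le n$. Then $$\nu_2\big(S(c2^{n+1},2^m-1)-S(c2^n, 2^m-1)\big)=n+1,$$ except when $n=m=2$ and $c=1$, in which case $\nu_2\big(S(8,3)-S(4,3)\big)=6$.
   Context: $S(n,k)$ denotes the Stirling number of the second kind (the number of partitions of an $n$-element set into exactly $k$ nonempty blocks). For a nonzero integer $m$, $\nu_2(m)$ denotes the 2-adic valuation of $m$. -}

module Defs where

open import Data.Nat using (ℕ; zero; suc; _+_; _*_; _^_)
open import Data.Integer using (ℤ; +_; _-_)
open import Data.Integer.Divisibility using (_∣_)
open import Data.Product using (_×_)
open import Relation.Nullary using (¬_)

-- Stirling numbers of the second kind, via the standard recurrence
-- S(0,0)=1, S(n+1,0)=0, S(0,k+1)=0, S(n+1,k+1) = (k+1) S(n,k+1) + S(n,k).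
S : ℕ → ℕ → ℕ
S zero    zero    = 1
S zero    (suc k) = 0
S (suc n) zero    = 0
S (suc n) (suc k) = suc k * S n (suc k) + S n k

-- 2-adic valuation as a relation: ν₂ x ≡ e  means  2^e ∣ x  and  ¬ 2^(e+1) ∣ x.
-- (For x = 0 no e satisfies this, so asserting ν₂ x = e entails x ≠ 0.)
ν₂≡ : ℤ → ℕ → Set
ν₂≡ x e = ((+ (2 ^ e)) ∣ x) × ¬ ((+ (2 ^ suc e)) ∣ x)

{-# OPTIONS --safe #-}
-- Put k = 2^m - 1, h = 2^(m-1) and N = c 2^n.  By inclusion-exclusion k! (S(2N,k) - S(N,k)) is
-- the alternating sum of C(k,j) (j^2N - j^N).  The even j together vanish modulo 2^(n+2) k!.  For
-- odd j = 2i+1 expand the powers by the binomial theorem and then in the basis C(i,r):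
-- with Σᵢ C(k,2i+1) C(i,r) = 2^(k-1-2r) C(k-1-r,r), division by k! leaves, up to odd factors,
--   Σ_{r<h} κ_r Σ_{t≥r} D_t 2^(t-r) S(t,r),   κ_r = C(2h-2-r, h-1),  D_t = C(2N,t) - C(N,t).
-- Since h ∣ (r+1) κ_r and 2^n ∣ t D_t, the terms with t ≥ r+2 vanish modulo 2^(n+2), and the
-- two remaining ones add up to (1-r²) D_r κ_r, which vanishes too unless r = h/2, where its
-- valuation is exactly n+1.  This needs m ≥ 3; for m = 2 use 6 S(N,3) = 3^N - 3·2^N + 3.
module Submission where

open import Defs
open import Data.Nat.Base as ℕ using (ℕ; zero; suc; z≤n; s≤s; _!)
import Data.Nat.Properties as ℕ
import Data.Nat.Divisibility as ℕ∣
import Data.Nat.Tactic.RingSolver as ℕ-Solver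
open import Data.Nat.Combinatorics using (_C_; nCk+nC[k+1]≡[n+1]C[k+1]; nCk≡n!/k![n-k]!; nCn≡1; nCk≡nC[n∸k]; k>n⇒nCk≡0; k![n∸k]!∣n!)
open import Data.Nat.DivMod using (_/_; m/n*n≡m)
open import Data.Nat.Induction using (<-rec)
open import Data.Integer.Base using (ℤ; +_; -_; _+_; _-_; _*_; _^_; 0ℤ; 1ℤ; -1ℤ; NonZero)
open import Data.Integer.Properties as ℤ using (pos-+; pos-*; ^-distribˡ-+-*)
import Data.Integer.Divisibility as ∣ᵤ
open import Data.Integer.Divisibility.Signed
open import Data.Integer.Tactic.RingSolver using (solve-∀)
open import Data.Empty using (⊥-elim)
open import Data.Product using (∃; ∃₂; _×_; _,_; proj₁; proj₂)
open import Data.Sum using (_⊎_; inj₁; inj₂)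
open import Function using (_∘_)
open import Relation.Binary.PropositionalEquality
open import Relation.Nullary using (¬_)
open import Relation.Nullary.Decidable using (toWitnessFalse)
open ≡-Reasoning

-- The obstacle is the division by k!, which costs k-m factors of 2: a congruence modulo 2^(n+2) for
-- the Stirling difference needs one modulo 2^(n+2+k-m) for the alternating sum. The Newton basis
-- lets the division be made term by term. With H = h-1, every term r of the sum over odd j contains
-- 2^H H! up to odd double factorials, and k! is 2^H H! times another one; odd factors are
-- multiplied out, never inverted. The terms with t ≥ r+2 vanish because r+1 and t are only t-r-1
-- apart: they cannot both absorb many factors of 2, and 2^(t-r) covers the loss. The value n+1 at r
-- = h/2 is the valuation of 2N: by absorption κ_r is h and D_r is N/r up to odd factors, and h/r =
-- 2. For h = 2 all of this breaks: the estimate for t ≥ r+2 is no longer strict, 1-r² is zero at r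
-- = h/2, and the sum over even j loses a factor 2. The exception is the case where 2^N is not
-- negligible in the formula for 6 S(N,3): at N = 4 both 3^N - 1 and 2^N have valuation 4, and they
-- interfere.

-- Finite sums of integers

Σ< : ℕ → (ℕ → ℤ) → ℤ
Σ< zero    f = 0ℤ
Σ< (suc n) f = f 0 + Σ< n (f ∘ suc)

Σ<-cong : ∀ n {f g} → (∀ i → f i ≡ g i) → Σ< n f ≡ Σ< n g
Σ<-cong zero    eq = refl
Σ<-cong (suc n) eq = cong₂ _+_ (eq 0) (Σ<-cong n (eq ∘ suc))

Σ<-cong-< : ∀ n {f g} → (∀ i → i ℕ.< n → f i ≡ g i) → Σ< n f ≡ Σ< n g
Σ<-cong-< zero    eq = refl
Σ<-cong-< (suc n) eq = cong₂ _+_ (eq 0 (s≤s z≤n)) (Σ<-cong-< n λ i i<n → eq (suc i) (s≤s i<n))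

Σ<-+ : ∀ n f g → Σ< n (λ i → f i + g i) ≡ Σ< n f + Σ< n g
Σ<-+ zero    f g = refl
Σ<-+ (suc n) f g = trans (cong (_+_ (f 0 + g 0)) (Σ<-+ n (f ∘ suc) (g ∘ suc)))
                         (interchange (f 0) (g 0) _ _)
  where
  interchange : ∀ a b c d → a + b + (c + d) ≡ a + c + (b + d)
  interchange = solve-∀

Σ<-* : ∀ n c f → Σ< n (λ i → c * f i) ≡ c * Σ< n f
Σ<-* zero    c f = sym (ℤ.*-zeroʳ c)
Σ<-* (suc n) c f = trans (cong (_+_ (c * f 0)) (Σ<-* n c (f ∘ suc))) (sym (ℤ.*-distribˡ-+ c (f 0) _))

Σ<-0 : ∀ n → Σ< n (λ _ → 0ℤ) ≡ 0ℤ
Σ<-0 zero    = refl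
Σ<-0 (suc n) = trans (ℤ.+-identityˡ _) (Σ<-0 n)

Σ<-split : ∀ m n f → Σ< (m ℕ.+ n) f ≡ Σ< m f + Σ< n (λ i → f (m ℕ.+ i))
Σ<-split zero    n f = sym (ℤ.+-identityˡ _)
Σ<-split (suc m) n f = trans (cong (_+_ (f 0)) (Σ<-split m n (f ∘ suc))) (sym (ℤ.+-assoc (f 0) _ _))

-- Iterated forward differences at 0

Δ : ℕ → (ℕ → ℤ) → ℤ
Δ zero    f = f 0
Δ (suc k) f = Δ k (λ i → f (suc i) - f i)

Δ-cong : ∀ k {f g} → (∀ i → f i ≡ g i) → Δ k f ≡ Δ k g
Δ-cong zero    eq = eq 0
Δ-cong (suc k) eq = Δ-cong k λ i → cong₂ _-_ (eq (suc i)) (eq i)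

Δ-+ : ∀ k f g → Δ k (λ i → f i + g i) ≡ Δ k f + Δ k g
Δ-+ zero    f g = refl
Δ-+ (suc k) f g = trans
  (Δ-cong k λ i → rearrange (f (suc i)) (g (suc i)) (f i) (g i))
  (Δ-+ k (λ i → f (suc i) - f i) (λ i → g (suc i) - g i))
  where
  rearrange : ∀ a b c d → (a + b) - (c + d) ≡ (a - c) + (b - d)
  rearrange = solve-∀

Δ-* : ∀ k c f → Δ k (λ i → c * f i) ≡ c * Δ k f
Δ-* zero    c f = refl
Δ-* (suc k) c f = trans
  (Δ-cong k λ i → factor c (f (suc i)) (f i))
  (Δ-* k c (λ i → f (suc i) - f i))
  where
  factor : ∀ c a b → c * a - c * b ≡ c * (a - b)
  factor = solve-∀

Δ-- : ∀ k f g → Δ k (λ i → f i - g i) ≡ Δ k f - Δ k g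
Δ-- k f g = begin
  Δ k (λ i → f i - g i)              ≡⟨ Δ-cong k (λ i → minus (f i) (g i)) ⟩
  Δ k (λ i → f i + -1ℤ * g i)        ≡⟨ Δ-+ k f (λ i → -1ℤ * g i) ⟩
  Δ k f + Δ k (λ i → -1ℤ * g i)      ≡⟨ cong (_+_ (Δ k f)) (Δ-* k -1ℤ g) ⟩
  Δ k f + -1ℤ * Δ k g                ≡⟨ minus (Δ k f) (Δ k g) ⟨
  Δ k f - Δ k g                      ∎
  where
  minus : ∀ a b → a - b ≡ a + -1ℤ * b
  minus = solve-∀

Δ-0 : ∀ k → Δ k (λ _ → 0ℤ) ≡ 0ℤ
Δ-0 zero    = refl
Δ-0 (suc k) = Δ-0 k

Δ-Σ : ∀ k n (c : ℕ → ℤ) (f : ℕ → ℕ → ℤ) →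
      Δ k (λ i → Σ< n (λ t → c t * f t i)) ≡ Σ< n (λ t → c t * Δ k (f t))
Δ-Σ k zero    c f = Δ-0 k
Δ-Σ k (suc n) c f = trans (Δ-+ k (λ i → c 0 * f 0 i) _)
  (cong₂ _+_ (Δ-* k (c 0) (f 0)) (Δ-Σ k n (c ∘ suc) (f ∘ suc)))

Δ-suc : ∀ k f → Δ (suc k) f ≡ Δ k (f ∘ suc) - Δ k f
Δ-suc k f = Δ-- k (f ∘ suc) f

-- Leibniz rule for differences, evaluated at 0: `i` has constant first difference, and the term
-- that leaves it undifferenced carries the factor 0.
Δ-id* : ∀ k g → Δ (suc k) (λ i → + i * g i) ≡ + suc k * Δ k (g ∘ suc)
Δ-id* zero    g = lemma (g 1) (g 0)
  where
  lemma : ∀ a b → 1ℤ * a - 0ℤ * b ≡ 1ℤ * a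
  lemma = solve-∀
Δ-id* (suc k) g = begin
  Δ (suc (suc k)) (λ i → + i * g i)
    ≡⟨ Δ-suc (suc k) (λ i → + i * g i) ⟩
  Δ (suc k) (λ i → + suc i * g (suc i)) - Δ (suc k) (λ i → + i * g i)
    ≡⟨ cong₂ _-_ shifted (Δ-id* k g) ⟩
  (+ suc k * Δ k (g ∘ suc ∘ suc) + Δ (suc k) (g ∘ suc)) - + suc k * Δ k (g ∘ suc)
    ≡⟨ collect (+ k) (Δ k (g ∘ suc ∘ suc)) _ _ (Δ-suc k (g ∘ suc)) ⟩
  + suc (suc k) * Δ (suc k) (g ∘ suc) ∎
  where
  shifted : Δ (suc k) (λ i → + suc i * g (suc i)) ≡ + suc k * Δ k (g ∘ suc ∘ suc) + Δ (suc k) (g ∘ suc)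
  shifted = begin
    Δ (suc k) (λ i → + suc i * g (suc i))
      ≡⟨ Δ-cong (suc k) (λ i → trans (ℤ.*-distribʳ-+ (g (suc i)) 1ℤ (+ i)) (trans (ℤ.+-comm _ (+ i * g (suc i))) (cong (_+_ (+ i * g (suc i))) (ℤ.*-identityˡ _)))) ⟩
    Δ (suc k) (λ i → + i * g (suc i) + g (suc i))
      ≡⟨ Δ-+ (suc k) (λ i → + i * g (suc i)) (g ∘ suc) ⟩
    Δ (suc k) (λ i → + i * g (suc i)) + Δ (suc k) (g ∘ suc)
      ≡⟨ cong (_+ Δ (suc k) (g ∘ suc)) (Δ-id* k (g ∘ suc)) ⟩
    + suc k * Δ k (g ∘ suc ∘ suc) + Δ (suc k) (g ∘ suc) ∎
  collect : ∀ k a b c → b ≡ a - c → ((1ℤ + k) * a + b) - (1ℤ + k) * c ≡ (1ℤ + (1ℤ + k)) * b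
  collect k a _ c refl = ring k a c
    where
    ring : ∀ k a c → ((1ℤ + k) * a + (a - c)) - (1ℤ + k) * c ≡ (1ℤ + (1ℤ + k)) * (a - c)
    ring = solve-∀

-- A k-th difference at 1 is the sum of the k-th and the (k+1)-st at 0, so the Leibniz rule becomes
-- the recurrence of `S` multiplied by (k+1)!.
Δ-pow : ∀ n k → Δ k (λ i → (+ i) ^ n) ≡ + (k !) * + S n k
Δ-pow zero    zero    = refl
Δ-pow zero    (suc k) = trans (Δ-0 k) (sym (ℤ.*-zeroʳ (+ (suc k !))))
Δ-pow (suc n) zero    = refl
Δ-pow (suc n) (suc k) = begin
  Δ (suc k) (λ i → + i * (+ i) ^ n)
    ≡⟨ Δ-id* k (λ i → (+ i) ^ n) ⟩
  + suc k * Δ k (λ i → (+ suc i) ^ n)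
    ≡⟨ cong (+ suc k *_) (solve-shift _ _ _ (Δ-suc k (λ i → (+ i) ^ n))) ⟩
  + suc k * (Δ (suc k) (λ i → (+ i) ^ n) + Δ k (λ i → (+ i) ^ n))
    ≡⟨ cong (+ suc k *_) (cong₂ _+_ (Δ-pow n (suc k)) (Δ-pow n k)) ⟩
  + suc k * (+ (suc k !) * + S n (suc k) + + (k !) * + S n k)
    ≡⟨ cong (λ z → + suc k * (z * + S n (suc k) + + (k !) * + S n k)) (pos-* (suc k) (k !)) ⟩
  + suc k * (+ suc k * + (k !) * + S n (suc k) + + (k !) * + S n k)
    ≡⟨ ring (+ suc k) (+ (k !)) (+ S n (suc k)) (+ S n k) ⟩
  + suc k * + (k !) * (+ suc k * + S n (suc k) + + S n k)
    ≡⟨ cong₂ _*_ (sym (pos-* (suc k) (k !)))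
                 (trans (cong (_+ + S n k) (sym (pos-* (suc k) (S n (suc k))))) (sym (pos-+ (suc k ℕ.* S n (suc k)) (S n k)))) ⟩
  + (suc k !) * + S (suc n) (suc k) ∎
  where
  solve-shift : ∀ a b c → a ≡ b - c → b ≡ a + c
  solve-shift _ b c refl = ring₁ b c
    where
    ring₁ : ∀ b c → b ≡ b - c + c
    ring₁ = solve-∀
  ring : ∀ k f a b → k * (k * f * a + f * b) ≡ k * f * (k * a + b)
  ring = solve-∀

-- odds k g = Σ C(k, 2i+1) g i  and  evens k g = Σ C(k, 2i) g i

odds evens : ℕ → (ℕ → ℤ) → ℤ
odds  zero    g = 0ℤ
odds  (suc k) g = odds k g + evens k g
evens zero    g = g 0
evens (suc k) g = evens k g + odds k (g ∘ suc)

odds-cong  : ∀ k {f g} → (∀ i → f i ≡ g i) → odds k f ≡ odds k g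
evens-cong : ∀ k {f g} → (∀ i → f i ≡ g i) → evens k f ≡ evens k g
odds-cong  zero    eq = refl
odds-cong  (suc k) eq = cong₂ _+_ (odds-cong k eq) (evens-cong k eq)
evens-cong zero    eq = eq 0
evens-cong (suc k) eq = cong₂ _+_ (evens-cong k eq) (odds-cong k (eq ∘ suc))

linear-interchange : ∀ c a b a′ b′ → (a + c * b) + (a′ + c * b′) ≡ (a + a′) + c * (b + b′)
linear-interchange = solve-∀

odds-linear  : ∀ k c f g → odds  k (λ i → f i + c * g i) ≡ odds  k f + c * odds  k g
evens-linear : ∀ k c f g → evens k (λ i → f i + c * g i) ≡ evens k f + c * evens k g
odds-linear  zero    c f g = sym (trans (ℤ.+-identityˡ _) (ℤ.*-zeroʳ c))
odds-linear  (suc k) c f g = trans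
  (cong₂ _+_ (odds-linear k c f g) (evens-linear k c f g))
  (linear-interchange c (odds k f) (odds k g) (evens k f) (evens k g))
evens-linear zero    c f g = refl
evens-linear (suc k) c f g = trans
  (cong₂ _+_ (evens-linear k c f g) (odds-linear k c (f ∘ suc) (g ∘ suc)))
  (linear-interchange c (evens k f) (evens k g) (odds k (f ∘ suc)) (odds k (g ∘ suc)))

-- In the alternating sum for `Δ k f` the sign of f(j) depends only on k and on the parity of j.
-- Shifting `f` exchanges the parity classes, as Pascal's rule does in `odds` and `evens`.
Δ-parity : ∀ k f → Δ k f ≡ -1ℤ ^ k * (evens k (λ i → f (i ℕ.* 2)) - odds k (λ i → f (suc (i ℕ.* 2))))
Δ-parity zero    f = ring (f 0)
  where
  ring : ∀ a → a ≡ 1ℤ * (a - 0ℤ)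
  ring = solve-∀
Δ-parity (suc k) f = begin
  Δ (suc k) f              ≡⟨ Δ-suc k f ⟩
  Δ k (f ∘ suc) - Δ k f    ≡⟨ cong₂ _-_ (Δ-parity k (f ∘ suc)) (Δ-parity k f) ⟩
  -1ℤ ^ k * (evens k o - odds k (e ∘ suc)) - -1ℤ ^ k * (evens k e - odds k o)
    ≡⟨ ring (-1ℤ ^ k) (evens k o) (odds k (e ∘ suc)) (evens k e) (odds k o) ⟩
  -1ℤ ^ suc k * (evens (suc k) e - odds (suc k) o) ∎
  where
  e o : ℕ → ℤ
  e i = f (i ℕ.* 2)
  o i = f (suc (i ℕ.* 2))
  ring : ∀ s a b c d → s * (a - b) - s * (c - d) ≡ -1ℤ * s * (c + b - (d + a))
  ring = solve-∀

Δ-parity-odd : ∀ j f → let k = suc (j ℕ.* 2) in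
  Δ k f ≡ odds k (λ i → f (suc (i ℕ.* 2))) - evens k (λ i → f (i ℕ.* 2))
Δ-parity-odd j f = trans (Δ-parity (suc (j ℕ.* 2)) f)
  (trans (cong (_* (e - o)) (sign j)) (ring e o))
  where
  e o : ℤ
  e = evens (suc (j ℕ.* 2)) (λ i → f (i ℕ.* 2))
  o = odds (suc (j ℕ.* 2)) (λ i → f (suc (i ℕ.* 2)))
  sign : ∀ j → -1ℤ ^ suc (j ℕ.* 2) ≡ -1ℤ
  sign zero    = refl
  sign (suc j) = cong (λ z → -1ℤ * (-1ℤ * z)) (sign j)
  ring : ∀ a b → -1ℤ * (a - b) ≡ b - a
  ring = solve-∀

-- With E the shift operator, `evens k` + `odds k` √E is (1 + √E)^k at 0, and 1 + √E is a root of z²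
-- = 2z + (E - 1). Here E - 1 is the forward difference, which is why the Newton basis appears.
odds-rec : ∀ k g → odds (suc (suc k)) g ≡ + 2 * odds (suc k) g + odds k (λ i → g (suc i) - g i)
odds-rec k g = begin
  odds k g + evens k g + (evens k g + odds k (g ∘ suc))
    ≡⟨ ring (odds k g) (evens k g) (odds k (g ∘ suc)) ⟩
  + 2 * odds (suc k) g + (odds k (g ∘ suc) + -1ℤ * odds k g)
    ≡⟨ cong (_+_ (+ 2 * odds (suc k) g)) (trans (sym (odds-linear k -1ℤ (g ∘ suc) g)) (odds-cong k λ i → minus (g (suc i)) (g i))) ⟩
  + 2 * odds (suc k) g + odds k (λ i → g (suc i) - g i) ∎
  where
  ring : ∀ a b c → a + b + (b + c) ≡ + 2 * (a + b) + (c + -1ℤ * a)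
  ring = solve-∀
  minus : ∀ a b → a + -1ℤ * b ≡ a - b
  minus = solve-∀

-- A k r = Σ C(k, 2i+1) C(i, r), the coordinates of odds k in the Newton basis
A : ℕ → ℕ → ℕ
A zero          r       = 0
A (suc zero)    zero    = 1
A (suc zero)    (suc r) = 0
A (suc (suc k)) zero    = 2 ℕ.* A (suc k) zero
A (suc (suc k)) (suc r) = 2 ℕ.* A (suc k) (suc r) ℕ.+ A k r

-- Each difference taken by `odds-rec` raises the Newton index by one and lowers k by two, so R
-- coefficients suffice when k ≤ 2R.
odds-newton : ∀ k R g → k ℕ.≤ R ℕ.* 2 → odds k g ≡ Σ< R (λ r → + A k r * Δ r g)
odds-newton zero       R       g _ = sym (Σ<-0 R)
odds-newton (suc zero) (suc R) g _ = begin
  0ℤ + g 0                                           ≡⟨ ring (g 0) ⟩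
  1ℤ * g 0 + 0ℤ                                      ≡⟨ cong (_+_ (1ℤ * g 0)) (Σ<-0 R) ⟨
  1ℤ * g 0 + Σ< R (λ _ → 0ℤ)                         ∎
  where
  ring : ∀ a → 0ℤ + a ≡ 1ℤ * a + 0ℤ
  ring = solve-∀
odds-newton (suc (suc k)) (suc R) g (s≤s (s≤s k≤)) = begin
  odds (suc (suc k)) g
    ≡⟨ odds-rec k g ⟩
  + 2 * odds (suc k) g + odds k ∂g
    ≡⟨ cong₂ (λ x y → + 2 * x + y) (odds-newton (suc k) (suc R) g (s≤s (ℕ.m≤n⇒m≤1+n k≤))) (odds-newton k R ∂g k≤) ⟩
  + 2 * (+ A (suc k) 0 * g 0 + Σ< R (λ r → + A (suc k) (suc r) * Δ r ∂g)) + Σ< R (λ r → + A k r * Δ r ∂g)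
    ≡⟨ ring (+ A (suc k) 0) (g 0) _ _ ⟩
  + 2 * + A (suc k) 0 * g 0 + (+ 2 * Σ< R (λ r → + A (suc k) (suc r) * Δ r ∂g) + Σ< R (λ r → + A k r * Δ r ∂g))
    ≡⟨ cong₂ _+_ (cong (_* g 0) (sym (pos-* 2 (A (suc k) 0)))) (sym tail) ⟩
  Σ< (suc R) (λ r → + A (suc (suc k)) r * Δ r g) ∎
  where
  ∂g : ℕ → ℤ
  ∂g i = g (suc i) - g i
  ring : ∀ a b c d → + 2 * (a * b + c) + d ≡ + 2 * a * b + (+ 2 * c + d)
  ring = solve-∀
  ring₂ : ∀ a b c → (+ 2 * a + b) * c ≡ + 2 * (a * c) + b * c
  ring₂ = solve-∀
  tail : Σ< R (λ r → + A (suc (suc k)) (suc r) * Δ r ∂g)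
       ≡ + 2 * Σ< R (λ r → + A (suc k) (suc r) * Δ r ∂g) + Σ< R (λ r → + A k r * Δ r ∂g)
  tail = begin
    Σ< R (λ r → + A (suc (suc k)) (suc r) * Δ r ∂g)
      ≡⟨ Σ<-cong R (λ r → trans
           (cong (_* Δ r ∂g) (trans (pos-+ (2 ℕ.* A (suc k) (suc r)) (A k r)) (cong (_+ + A k r) (pos-* 2 (A (suc k) (suc r))))))
           (ring₂ (+ A (suc k) (suc r)) (+ A k r) (Δ r ∂g))) ⟩
    Σ< R (λ r → + 2 * (+ A (suc k) (suc r) * Δ r ∂g) + + A k r * Δ r ∂g)
      ≡⟨ Σ<-+ R _ _ ⟩
    Σ< R (λ r → + 2 * (+ A (suc k) (suc r) * Δ r ∂g)) + Σ< R (λ r → + A k r * Δ r ∂g)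
      ≡⟨ cong (_+ Σ< R (λ r → + A k r * Δ r ∂g)) (Σ<-* R (+ 2) _) ⟩
    + 2 * Σ< R (λ r → + A (suc k) (suc r) * Δ r ∂g) + Σ< R (λ r → + A k r * Δ r ∂g) ∎

A≡0 : ∀ k r → k ℕ.≤ r ℕ.* 2 → A k r ≡ 0
A≡0 zero          r       _             = refl
A≡0 (suc zero)    (suc r) _             = refl
A≡0 (suc (suc k)) (suc r) (s≤s (s≤s k≤))
  rewrite A≡0 (suc k) (suc r) (s≤s (ℕ.m≤n⇒m≤1+n k≤)) | A≡0 k r k≤ = refl

-- With k = 2r+1+p and the power 2^p divided out, the recurrence of `A` is Pascal's rule.
A-closed : ∀ r p → A (suc (r ℕ.* 2 ℕ.+ p)) r ≡ 2 ℕ.^ p ℕ.* ((r ℕ.+ p) C r)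
A-closed zero    zero    = refl
A-closed zero    (suc p) = trans (cong (2 ℕ.*_) (A-closed zero p)) (sym (ℕ.*-assoc 2 (2 ℕ.^ p) 1))
A-closed (suc r) zero    = begin
  2 ℕ.* A (suc (suc (r ℕ.* 2 ℕ.+ 0))) (suc r) ℕ.+ A (suc (r ℕ.* 2 ℕ.+ 0)) r
    ≡⟨ cong₂ (λ x y → 2 ℕ.* x ℕ.+ y) (A≡0 _ (suc r) (s≤s (s≤s (ℕ.≤-reflexive (ℕ.+-identityʳ (r ℕ.* 2)))))) (A-closed r 0) ⟩
  1 ℕ.* ((r ℕ.+ 0) C r)
    ≡⟨ cong (1 ℕ.*_) (trans (C-diag r) (sym (C-diag (suc r)))) ⟩
  1 ℕ.* ((suc r ℕ.+ 0) C suc r) ∎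
  where
  C-diag : ∀ r → (r ℕ.+ 0) C r ≡ 1
  C-diag r = trans (cong (_C r) (ℕ.+-identityʳ r)) (nCn≡1 r)
A-closed (suc r) (suc p) = begin
  2 ℕ.* A (suc (suc (r ℕ.* 2 ℕ.+ suc p))) (suc r) ℕ.+ A (suc (r ℕ.* 2 ℕ.+ suc p)) r
    ≡⟨ cong₂ (λ x y → 2 ℕ.* A (suc (suc x)) (suc r) ℕ.+ y) (ℕ.+-suc (r ℕ.* 2) p) (A-closed r (suc p)) ⟩
  2 ℕ.* A (suc (suc r ℕ.* 2 ℕ.+ p)) (suc r) ℕ.+ 2 ℕ.^ suc p ℕ.* ((r ℕ.+ suc p) C r)
    ≡⟨ cong (λ x → 2 ℕ.* x ℕ.+ 2 ℕ.^ suc p ℕ.* ((r ℕ.+ suc p) C r)) (trans (A-closed (suc r) p) (cong (λ x → 2 ℕ.^ p ℕ.* (x C suc r)) (sym (ℕ.+-suc r p)))) ⟩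
  2 ℕ.* (2 ℕ.^ p ℕ.* ((r ℕ.+ suc p) C suc r)) ℕ.+ 2 ℕ.^ suc p ℕ.* ((r ℕ.+ suc p) C r)
    ≡⟨ ring (2 ℕ.^ p) ((r ℕ.+ suc p) C suc r) ((r ℕ.+ suc p) C r) ⟩
  2 ℕ.^ suc p ℕ.* ((r ℕ.+ suc p) C r ℕ.+ (r ℕ.+ suc p) C suc r)
    ≡⟨ cong (2 ℕ.^ suc p ℕ.*_) (nCk+nC[k+1]≡[n+1]C[k+1] (r ℕ.+ suc p) r) ⟩
  2 ℕ.^ suc p ℕ.* ((suc r ℕ.+ suc p) C suc r) ∎
  where
  ring : ∀ q a b → 2 ℕ.* (q ℕ.* a) ℕ.+ 2 ℕ.* q ℕ.* b ≡ 2 ℕ.* q ℕ.* (b ℕ.+ a)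
  ring = ℕ-Solver.solve-∀

-- Binomial coefficients, factorials and odd double factorials

C-factorial : ∀ a b → ((a ℕ.+ b) C a) ℕ.* (a ! ℕ.* b !) ≡ (a ℕ.+ b) !
C-factorial a b = begin
  ((a ℕ.+ b) C a) ℕ.* (a ! ℕ.* b !)
    ≡⟨ cong (λ z → ((a ℕ.+ b) C a) ℕ.* (a ! ℕ.* z !)) (ℕ.m+n∸m≡n a b) ⟨
  ((a ℕ.+ b) C a) ℕ.* (a ! ℕ.* (a ℕ.+ b ℕ.∸ a) !)
    ≡⟨ cong (ℕ._* (a ! ℕ.* (a ℕ.+ b ℕ.∸ a) !)) (nCk≡n!/k![n-k]! a≤a+b) ⟩
  (a ℕ.+ b) ! / (a ! ℕ.* (a ℕ.+ b ℕ.∸ a) !) ℕ.* (a ! ℕ.* (a ℕ.+ b ℕ.∸ a) !)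
    ≡⟨ m/n*n≡m (k![n∸k]!∣n! a≤a+b) ⟩
  (a ℕ.+ b) ! ∎
  where
  a≤a+b = ℕ.m≤m+n a b
  instance _ = ℕ._!*_!≢0 a (a ℕ.+ b ℕ.∸ a)

C-absorb : ∀ n k → suc k ℕ.* (suc n C suc k) ≡ suc n ℕ.* (n C k)
C-absorb zero    zero    = refl
C-absorb zero    (suc k) = begin
  suc (suc k) ℕ.* (1 C suc (suc k)) ≡⟨ cong (suc (suc k) ℕ.*_) (k>n⇒nCk≡0 {1} {suc (suc k)} (s≤s (s≤s z≤n))) ⟩
  suc (suc k) ℕ.* 0                 ≡⟨ ℕ.*-zeroʳ (suc (suc k)) ⟩
  1 ℕ.* 0                           ≡⟨ cong (1 ℕ.*_) (k>n⇒nCk≡0 {0} {suc k} (s≤s z≤n)) ⟨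
  1 ℕ.* (0 C suc k)                 ∎
C-absorb (suc n) zero    = begin
  1 ℕ.* (suc (suc n) C 1)             ≡⟨ cong (1 ℕ.*_) (nCk+nC[k+1]≡[n+1]C[k+1] (suc n) 0) ⟨
  1 ℕ.* (1 ℕ.+ (suc n C 1))           ≡⟨ ℕ.*-distribˡ-+ 1 1 (suc n C 1) ⟩
  1 ℕ.+ 1 ℕ.* (suc n C 1)             ≡⟨ cong (1 ℕ.+_) (C-absorb n 0) ⟩
  suc (suc n) ℕ.* 1                   ∎
C-absorb (suc n) (suc k) = begin
  suc (suc k) ℕ.* (suc (suc n) C suc (suc k))
    ≡⟨ cong (suc (suc k) ℕ.*_) (nCk+nC[k+1]≡[n+1]C[k+1] (suc n) (suc k)) ⟨
  suc (suc k) ℕ.* ((suc n C suc k) ℕ.+ (suc n C suc (suc k)))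
    ≡⟨ ring₁ k (suc n C suc k) (suc n C suc (suc k)) ⟩
  (suc n C suc k) ℕ.+ (suc k ℕ.* (suc n C suc k) ℕ.+ suc (suc k) ℕ.* (suc n C suc (suc k)))
    ≡⟨ cong₂ (λ x y → (suc n C suc k) ℕ.+ (x ℕ.+ y)) (C-absorb n k) (C-absorb n (suc k)) ⟩
  (suc n C suc k) ℕ.+ (suc n ℕ.* (n C k) ℕ.+ suc n ℕ.* (n C suc k))
    ≡⟨ cong ((suc n C suc k) ℕ.+_) (trans (sym (ℕ.*-distribˡ-+ (suc n) (n C k) (n C suc k))) (cong (suc n ℕ.*_) (nCk+nC[k+1]≡[n+1]C[k+1] n k))) ⟩
  suc (suc n) ℕ.* (suc n C suc k) ∎
  where
  ring₁ : ∀ k a b → suc (suc k) ℕ.* (a ℕ.+ b) ≡ a ℕ.+ (suc k ℕ.* a ℕ.+ suc (suc k) ℕ.* b)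
  ring₁ = ℕ-Solver.solve-∀

C-absorb-ℤ : ∀ n k → + suc k * + (suc n C suc k) ≡ + suc n * + (n C k)
C-absorb-ℤ n k = begin
  + suc k * + (suc n C suc k)     ≡⟨ pos-* (suc k) (suc n C suc k) ⟨
  + (suc k ℕ.* (suc n C suc k))   ≡⟨ cong +_ (C-absorb n k) ⟩
  + (suc n ℕ.* (n C k))           ≡⟨ pos-* (suc n) (n C k) ⟩
  + suc n * + (n C k)             ∎

-- dfact s = (2s-1)!!
dfact : ℕ → ℕ
dfact zero    = 1
dfact (suc s) = suc (s ℕ.* 2) ℕ.* dfact s

!-even : ∀ s → (s ℕ.* 2) ! ≡ 2 ℕ.^ s ℕ.* s ! ℕ.* dfact s
!-even zero    = refl
!-even (suc s) = trans (cong (λ z → suc (suc (s ℕ.* 2)) ℕ.* (suc (s ℕ.* 2) ℕ.* z)) (!-even s))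
                       (ring s (2 ℕ.^ s) (s !) (dfact s))
  where
  ring : ∀ s q f d → suc (suc (s ℕ.* 2)) ℕ.* (suc (s ℕ.* 2) ℕ.* (q ℕ.* f ℕ.* d)) ≡
         2 ℕ.* q ℕ.* (suc s ℕ.* f) ℕ.* (suc (s ℕ.* 2) ℕ.* d)
  ring = ℕ-Solver.solve-∀

!-odd : ∀ s → suc (s ℕ.* 2) ! ≡ 2 ℕ.^ s ℕ.* s ! ℕ.* dfact (suc s)
!-odd s = trans (cong (suc (s ℕ.* 2) ℕ.*_) (!-even s)) (ring s (2 ℕ.^ s ℕ.* s !) (dfact s))
  where
  ring : ∀ s q d → suc (s ℕ.* 2) ℕ.* (q ℕ.* d) ≡ q ℕ.* (suc (s ℕ.* 2) ℕ.* d)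
  ring = ℕ-Solver.solve-∀

-- After multiplication by 2^s s! both sides are 2^(H+s) (H+s)!, because (2s)! = 2^s s! `dfact s`
-- and r+2s = H+s. The gain is that 2^H H! on the right is independent of r and occurs in (2H+1)! as
-- well.
A-dfact : ∀ r s → let H = r ℕ.+ s in
  2 ℕ.^ r ℕ.* r ! ℕ.* A (suc (H ℕ.* 2)) r ℕ.* dfact s ≡ 2 ℕ.^ H ℕ.* H ! ℕ.* ((H ℕ.+ s) C H)
A-dfact r s = ℕ.*-cancelʳ-≡ _ _ (2 ℕ.^ s ℕ.* s !) {{nz}} (begin
  2 ℕ.^ r ℕ.* r ! ℕ.* A (suc ((r ℕ.+ s) ℕ.* 2)) r ℕ.* dfact s ℕ.* (2 ℕ.^ s ℕ.* s !)
    ≡⟨ cong (λ z → 2 ℕ.^ r ℕ.* r ! ℕ.* A (suc z) r ℕ.* dfact s ℕ.* (2 ℕ.^ s ℕ.* s !)) (ℕ.*-distribʳ-+ 2 r s) ⟩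
  2 ℕ.^ r ℕ.* r ! ℕ.* A (suc (r ℕ.* 2 ℕ.+ s ℕ.* 2)) r ℕ.* dfact s ℕ.* (2 ℕ.^ s ℕ.* s !)
    ≡⟨ cong (λ z → 2 ℕ.^ r ℕ.* r ! ℕ.* z ℕ.* dfact s ℕ.* (2 ℕ.^ s ℕ.* s !)) (A-closed r (s ℕ.* 2)) ⟩
  2 ℕ.^ r ℕ.* r ! ℕ.* (2 ℕ.^ (s ℕ.* 2) ℕ.* ((r ℕ.+ s ℕ.* 2) C r)) ℕ.* dfact s ℕ.* (2 ℕ.^ s ℕ.* s !)
    ≡⟨ ring₁ (2 ℕ.^ r) (r !) (2 ℕ.^ (s ℕ.* 2)) ((r ℕ.+ s ℕ.* 2) C r) (dfact s) (2 ℕ.^ s) (s !) ⟩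
  2 ℕ.^ r ℕ.* 2 ℕ.^ (s ℕ.* 2) ℕ.* (((r ℕ.+ s ℕ.* 2) C r) ℕ.* (r ! ℕ.* (2 ℕ.^ s ℕ.* s ! ℕ.* dfact s)))
    ≡⟨ cong₂ ℕ._*_ powers (trans (cong (λ z → ((r ℕ.+ s ℕ.* 2) C r) ℕ.* (r ! ℕ.* z)) (sym (!-even s))) (C-factorial r (s ℕ.* 2))) ⟩
  2 ℕ.^ (r ℕ.+ s) ℕ.* 2 ℕ.^ s ℕ.* (r ℕ.+ s ℕ.* 2) !
    ≡⟨ cong (λ z → 2 ℕ.^ (r ℕ.+ s) ℕ.* 2 ℕ.^ s ℕ.* z !) (index r s) ⟩
  2 ℕ.^ (r ℕ.+ s) ℕ.* 2 ℕ.^ s ℕ.* (r ℕ.+ s ℕ.+ s) !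
    ≡⟨ cong (2 ℕ.^ (r ℕ.+ s) ℕ.* 2 ℕ.^ s ℕ.*_) (C-factorial (r ℕ.+ s) s) ⟨
  2 ℕ.^ (r ℕ.+ s) ℕ.* 2 ℕ.^ s ℕ.* (((r ℕ.+ s ℕ.+ s) C (r ℕ.+ s)) ℕ.* ((r ℕ.+ s) ! ℕ.* s !))
    ≡⟨ ring₂ (2 ℕ.^ (r ℕ.+ s)) (2 ℕ.^ s) ((r ℕ.+ s ℕ.+ s) C (r ℕ.+ s)) ((r ℕ.+ s) !) (s !) ⟩
  2 ℕ.^ (r ℕ.+ s) ℕ.* (r ℕ.+ s) ! ℕ.* ((r ℕ.+ s ℕ.+ s) C (r ℕ.+ s)) ℕ.* (2 ℕ.^ s ℕ.* s !) ∎)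
  where
  nz : ℕ.NonZero (2 ℕ.^ s ℕ.* s !)
  nz = ℕ.m*n≢0 (2 ℕ.^ s) (s !) {{ℕ.m^n≢0 2 s}} {{s ℕ.!≢0}}
  index : ∀ r s → r ℕ.+ s ℕ.* 2 ≡ r ℕ.+ s ℕ.+ s
  index = ℕ-Solver.solve-∀
  powers : 2 ℕ.^ r ℕ.* 2 ℕ.^ (s ℕ.* 2) ≡ 2 ℕ.^ (r ℕ.+ s) ℕ.* 2 ℕ.^ s
  powers = begin
    2 ℕ.^ r ℕ.* 2 ℕ.^ (s ℕ.* 2)       ≡⟨ ℕ.^-distribˡ-+-* 2 r (s ℕ.* 2) ⟨
    2 ℕ.^ (r ℕ.+ s ℕ.* 2)             ≡⟨ cong (2 ℕ.^_) (index r s) ⟩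
    2 ℕ.^ (r ℕ.+ s ℕ.+ s)             ≡⟨ ℕ.^-distribˡ-+-* 2 (r ℕ.+ s) s ⟩
    2 ℕ.^ (r ℕ.+ s) ℕ.* 2 ℕ.^ s       ∎
  ring₁ : ∀ a f b c d q e → a ℕ.* f ℕ.* (b ℕ.* c) ℕ.* d ℕ.* (q ℕ.* e) ≡ a ℕ.* b ℕ.* (c ℕ.* (f ℕ.* (q ℕ.* e ℕ.* d)))
  ring₁ = ℕ-Solver.solve-∀
  ring₂ : ∀ a b c f e → a ℕ.* b ℕ.* (c ℕ.* (f ℕ.* e)) ≡ a ℕ.* f ℕ.* c ℕ.* (b ℕ.* e)
  ring₂ = ℕ-Solver.solve-∀

-- Stirling numbers near the diagonal

S-above : ∀ n k → n ℕ.< k → S n k ≡ 0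
S-above zero    (suc k) _         = refl
S-above (suc n) (suc k) (s≤s n<k)
  rewrite S-above n (suc k) (ℕ.m<n⇒m<1+n n<k) | S-above n k n<k = cong (ℕ._+ 0) (ℕ.*-zeroʳ k)

S-diag : ∀ n → S n n ≡ 1
S-diag zero    = refl
S-diag (suc n) rewrite S-above n (suc n) (ℕ.n<1+n n) | S-diag n = cong (ℕ._+ 1) (ℕ.*-zeroʳ n)

-- The factor 2 that avoids halving is the power 2^(t-r) at t = r+1.
S-subdiag : ∀ n → 2 ℕ.* S (suc n) n ≡ n ℕ.* suc n
S-subdiag zero    = refl
S-subdiag (suc n) = begin
  2 ℕ.* (suc n ℕ.* S (suc n) (suc n) ℕ.+ S (suc n) n)
    ≡⟨ cong (λ z → 2 ℕ.* (suc n ℕ.* z ℕ.+ S (suc n) n)) (S-diag (suc n)) ⟩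
  2 ℕ.* (suc n ℕ.* 1 ℕ.+ S (suc n) n)
    ≡⟨ ring₁ n (S (suc n) n) ⟩
  2 ℕ.* suc n ℕ.+ 2 ℕ.* S (suc n) n
    ≡⟨ cong (2 ℕ.* suc n ℕ.+_) (S-subdiag n) ⟩
  2 ℕ.* suc n ℕ.+ n ℕ.* suc n
    ≡⟨ ring₂ n ⟩
  suc n ℕ.* suc (suc n) ∎
  where
  ring₁ : ∀ n s → 2 ℕ.* (suc n ℕ.* 1 ℕ.+ s) ≡ 2 ℕ.* suc n ℕ.+ 2 ℕ.* s
  ring₁ = ℕ-Solver.solve-∀
  ring₂ : ∀ n → 2 ℕ.* suc n ℕ.+ n ℕ.* suc n ≡ suc n ℕ.* suc (suc n)
  ring₂ = ℕ-Solver.solve-∀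

-- Binomial expansion of the powers of odd numbers

-- The length K is left free so that the N-th and the 2N-th power can be expanded over the same
-- range and subtracted term by term.
binomial-theorem : ∀ n K x → n ℕ.< K → (1ℤ + x) ^ n ≡ Σ< K (λ t → + (n C t) * x ^ t)
binomial-theorem zero    (suc K) x _         = begin
  1ℤ                                            ≡⟨ ℤ.+-identityʳ 1ℤ ⟨
  1ℤ * 1ℤ + 0ℤ                                  ≡⟨ cong (_+_ (1ℤ * 1ℤ)) (Σ<-0 K) ⟨
  1ℤ * 1ℤ + Σ< K (λ _ → 0ℤ)                     ≡⟨ cong (_+_ (1ℤ * 1ℤ)) (Σ<-cong K λ t →
    cong (λ z → + z * x ^ suc t) (k>n⇒nCk≡0 {0} {suc t} (s≤s z≤n))) ⟨
  Σ< (suc K) (λ t → + (0 C t) * x ^ t)          ∎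
binomial-theorem (suc n) (suc K) x (s≤s n<K) = begin
  (1ℤ + x) * (1ℤ + x) ^ n
    ≡⟨ ℤ.*-distribʳ-+ ((1ℤ + x) ^ n) 1ℤ x ⟩
  1ℤ * (1ℤ + x) ^ n + x * (1ℤ + x) ^ n
    ≡⟨ cong₂ _+_ (trans (ℤ.*-identityˡ _) (binomial-theorem n (suc K) x (ℕ.m<n⇒m<1+n n<K))) (cong (x *_) (binomial-theorem n K x n<K)) ⟩
  (1ℤ * 1ℤ + Σ< K (λ t → + (n C suc t) * x ^ suc t)) + x * Σ< K (λ t → + (n C t) * x ^ t)
    ≡⟨ rearrange (1ℤ * 1ℤ) (Σ< K (λ t → + (n C suc t) * x ^ suc t)) (x * Σ< K (λ t → + (n C t) * x ^ t)) ⟩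
  1ℤ * 1ℤ + (x * Σ< K (λ t → + (n C t) * x ^ t) + Σ< K (λ t → + (n C suc t) * x ^ suc t))
    ≡⟨ cong (λ z → 1ℤ * 1ℤ + (z + Σ< K (λ t → + (n C suc t) * x ^ suc t))) (sym (Σ<-* K x _)) ⟩
  1ℤ * 1ℤ + (Σ< K (λ t → x * (+ (n C t) * x ^ t)) + Σ< K (λ t → + (n C suc t) * x ^ suc t))
    ≡⟨ cong (_+_ (1ℤ * 1ℤ)) (sym (Σ<-+ K _ _)) ⟩
  1ℤ * 1ℤ + Σ< K (λ t → x * (+ (n C t) * x ^ t) + + (n C suc t) * x ^ suc t)
    ≡⟨ cong (_+_ (1ℤ * 1ℤ)) (Σ<-cong K pascal) ⟩
  Σ< (suc K) (λ t → + (suc n C t) * x ^ t) ∎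
  where
  rearrange : ∀ a b c → (a + b) + c ≡ a + (c + b)
  rearrange = solve-∀
  ring : ∀ x a b p → x * (a * p) + b * (x * p) ≡ (a + b) * (x * p)
  ring = solve-∀
  pascal : ∀ t → x * (+ (n C t) * x ^ t) + + (n C suc t) * x ^ suc t ≡ + (suc n C suc t) * x ^ suc t
  pascal t = trans (ring x (+ (n C t)) (+ (n C suc t)) (x ^ t))
    (cong (_* x ^ suc t) (trans (sym (pos-+ (n C t) (n C suc t))) (cong +_ (nCk+nC[k+1]≡[n+1]C[k+1] n t))))

^-distribʳ-* : ∀ n x y → (x * y) ^ n ≡ x ^ n * y ^ n
^-distribʳ-* zero    x y = refl
^-distribʳ-* (suc n) x y = trans (cong (x * y *_) (^-distribʳ-* n x y)) (ring x y (x ^ n) (y ^ n))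
  where
  ring : ∀ x y a b → x * y * (a * b) ≡ x * a * (y * b)
  ring = solve-∀

D : ℕ → ℕ → ℤ
D N t = + ((N ℕ.* 2) C t) - + (N C t)

-- The inner sum over t, with t = r + b running up to 2N.
Y : ℕ → ℕ → ℤ
Y N r = Σ< (suc (N ℕ.* 2) ℕ.∸ r) (λ b → D N (r ℕ.+ b) * ((+ 2) ^ b * + S (r ℕ.+ b) r))

odd-powers : ℕ → ℕ → ℤ
odd-powers N i = (+ suc (i ℕ.* 2)) ^ (N ℕ.* 2) - (+ suc (i ℕ.* 2)) ^ N

odd-powers-expand : ∀ N i →
  odd-powers N i ≡ Σ< (suc (N ℕ.* 2)) (λ t → D N t * (+ 2) ^ t * (+ i) ^ t)
odd-powers-expand N i = begin
  (1ℤ + + (i ℕ.* 2)) ^ (N ℕ.* 2) - (1ℤ + + (i ℕ.* 2)) ^ N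
    ≡⟨ cong (λ z → (1ℤ + z) ^ (N ℕ.* 2) - (1ℤ + z) ^ N) (trans (pos-* i 2) (ℤ.*-comm (+ i) (+ 2))) ⟩
  (1ℤ + x) ^ (N ℕ.* 2) - (1ℤ + x) ^ N
    ≡⟨ cong₂ _-_ (binomial-theorem (N ℕ.* 2) K x ℕ.≤-refl) (binomial-theorem N K x (s≤s (ℕ.m≤m*n N 2))) ⟩
  Σ< K u - Σ< K v
    ≡⟨ minus (Σ< K u) (Σ< K v) ⟩
  Σ< K u + -1ℤ * Σ< K v
    ≡⟨ cong (_+_ (Σ< K u)) (Σ<-* K -1ℤ v) ⟨
  Σ< K u + Σ< K (λ t → -1ℤ * v t)
    ≡⟨ Σ<-+ K u (λ t → -1ℤ * v t) ⟨
  Σ< K (λ t → u t + -1ℤ * v t)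
    ≡⟨ Σ<-cong K (λ t → trans (cong (λ p → + ((N ℕ.* 2) C t) * p + -1ℤ * (+ (N C t) * p)) (^-distribʳ-* t (+ 2) (+ i)))
        (ring (+ ((N ℕ.* 2) C t)) (+ (N C t)) ((+ 2) ^ t) ((+ i) ^ t))) ⟩
  Σ< K (λ t → D N t * (+ 2) ^ t * (+ i) ^ t) ∎
  where
  K = suc (N ℕ.* 2)
  x = + 2 * + i
  u v : ℕ → ℤ
  u t = + ((N ℕ.* 2) C t) * x ^ t
  v t = + (N C t) * x ^ t
  minus : ∀ a b → a - b ≡ a + -1ℤ * b
  minus = solve-∀
  ring : ∀ a b p q → a * (p * q) + -1ℤ * (b * (p * q)) ≡ (a - b) * p * q
  ring = solve-∀

-- The terms t < r vanish with `S t r`; every other one releases r! from the difference of i^t and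
-- 2^r from 2^t. This is the factor that `A-dfact` needs.
Δ-odd-powers : ∀ N r → r ℕ.≤ N → Δ r (odd-powers N) ≡ (+ 2) ^ r * + (r !) * Y N r
Δ-odd-powers N r r≤N = begin
  Δ r (odd-powers N)
    ≡⟨ Δ-cong r (odd-powers-expand N) ⟩
  Δ r (λ i → Σ< K (λ t → D N t * (+ 2) ^ t * (+ i) ^ t))
    ≡⟨ Δ-Σ r K (λ t → D N t * (+ 2) ^ t) (λ t i → (+ i) ^ t) ⟩
  Σ< K (λ t → D N t * (+ 2) ^ t * Δ r (λ i → (+ i) ^ t))
    ≡⟨ Σ<-cong K (λ t → cong (D N t * (+ 2) ^ t *_) (Δ-pow t r)) ⟩
  Σ< K F
    ≡⟨ cong (λ z → Σ< z F) (sym (ℕ.m+[n∸m]≡n r≤K)) ⟩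
  Σ< (r ℕ.+ (K ℕ.∸ r)) F
    ≡⟨ Σ<-split r (K ℕ.∸ r) F ⟩
  Σ< r F + Σ< (K ℕ.∸ r) (λ b → F (r ℕ.+ b))
    ≡⟨ cong₂ _+_ (trans (Σ<-cong-< r F≡0) (Σ<-0 r)) (Σ<-cong (K ℕ.∸ r) regroup) ⟩
  0ℤ + Σ< (K ℕ.∸ r) (λ b → (+ 2) ^ r * + (r !) * (D N (r ℕ.+ b) * ((+ 2) ^ b * + S (r ℕ.+ b) r)))
    ≡⟨ trans (ℤ.+-identityˡ _) (Σ<-* (K ℕ.∸ r) ((+ 2) ^ r * + (r !)) _) ⟩
  (+ 2) ^ r * + (r !) * Y N r ∎
  where
  K = suc (N ℕ.* 2)
  r≤K : r ℕ.≤ K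
  r≤K = ℕ.m≤n⇒m≤1+n (ℕ.≤-trans r≤N (ℕ.m≤m*n N 2))
  F : ℕ → ℤ
  F t = D N t * (+ 2) ^ t * (+ (r !) * + S t r)
  F≡0 : ∀ t → t ℕ.< r → F t ≡ 0ℤ
  F≡0 t t<r = trans (cong (λ z → D N t * (+ 2) ^ t * (+ (r !) * + z)) (S-above t r t<r))
    (trans (cong (D N t * (+ 2) ^ t *_) (ℤ.*-zeroʳ (+ (r !)))) (ℤ.*-zeroʳ (D N t * (+ 2) ^ t)))
  ring : ∀ d p q f s → d * (p * q) * (f * s) ≡ p * f * (d * (q * s))
  ring = solve-∀
  regroup : ∀ b → F (r ℕ.+ b) ≡ (+ 2) ^ r * + (r !) * (D N (r ℕ.+ b) * ((+ 2) ^ b * + S (r ℕ.+ b) r))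
  regroup b = trans (cong (λ z → D N (r ℕ.+ b) * z * (+ (r !) * + S (r ℕ.+ b) r)) (^-distribˡ-+-* (+ 2) r b))
    (ring (D N (r ℕ.+ b)) ((+ 2) ^ r) ((+ 2) ^ b) (+ (r !)) (+ S (r ℕ.+ b) r))

even-powers : ℕ → ℕ → ℤ
even-powers N i = (+ (i ℕ.* 2)) ^ (N ℕ.* 2) - (+ (i ℕ.* 2)) ^ N

Δ-powers : ∀ N k → + (k !) * (+ S (N ℕ.* 2) k - + S N k) ≡ Δ k (λ i → (+ i) ^ (N ℕ.* 2) - (+ i) ^ N)
Δ-powers N k = begin
  + (k !) * (+ S (N ℕ.* 2) k - + S N k)
    ≡⟨ ring (+ (k !)) (+ S (N ℕ.* 2) k) (+ S N k) ⟩
  + (k !) * + S (N ℕ.* 2) k - + (k !) * + S N k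
    ≡⟨ cong₂ _-_ (Δ-pow (N ℕ.* 2) k) (Δ-pow N k) ⟨
  Δ k (λ i → (+ i) ^ (N ℕ.* 2)) - Δ k (λ i → (+ i) ^ N)
    ≡⟨ Δ-- k (λ i → (+ i) ^ (N ℕ.* 2)) (λ i → (+ i) ^ N) ⟨
  Δ k (λ i → (+ i) ^ (N ℕ.* 2) - (+ i) ^ N) ∎
  where
  ring : ∀ f a b → f * (a - b) ≡ f * a - f * b
  ring = solve-∀

S-difference : ∀ H N → H ℕ.≤ N → let k = suc (H ℕ.* 2) in
  + (k !) * (+ S (N ℕ.* 2) k - + S N k) ≡
  Σ< (suc H) (λ r → + A k r * ((+ 2) ^ r * + (r !) * Y N r)) - evens k (even-powers N)
S-difference H N H≤N = begin
  + (k !) * (+ S (N ℕ.* 2) k - + S N k)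
    ≡⟨ Δ-powers N k ⟩
  Δ k (λ i → (+ i) ^ (N ℕ.* 2) - (+ i) ^ N)
    ≡⟨ Δ-parity-odd H (λ i → (+ i) ^ (N ℕ.* 2) - (+ i) ^ N) ⟩
  odds k (odd-powers N) - evens k (even-powers N)
    ≡⟨ cong (_- evens k (even-powers N)) (trans
         (odds-newton k (suc H) (odd-powers N) (ℕ.n≤1+n k))
         (Σ<-cong-< (suc H) λ r r≤H → cong (+ A k r *_) (Δ-odd-powers N r (ℕ.≤-trans (ℕ.≤-pred r≤H) H≤N)))) ⟩
  Σ< (suc H) (λ r → + A k r * ((+ 2) ^ r * + (r !) * Y N r)) - evens k (even-powers N) ∎
  where
  k = suc (H ℕ.* 2)

-- Powers of 2, odd integers and exact valuations

pos-2^ : ∀ e → + (2 ℕ.^ e) ≡ (+ 2) ^ e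
pos-2^ zero    = refl
pos-2^ (suc e) = trans (pos-* 2 (2 ℕ.^ e)) (cong (+ 2 *_) (pos-2^ e))

2^≢0 : ∀ e → NonZero ((+ 2) ^ e)
2^≢0 e = subst NonZero (pos-2^ e) (ℕ.m^n≢0 2 e)

2^-mono-∣ : ∀ {a b} → a ℕ.≤ b → (+ 2) ^ a ∣ (+ 2) ^ b
2^-mono-∣ {a} {b} a≤b = divides ((+ 2) ^ (b ℕ.∸ a)) (begin
  (+ 2) ^ b                        ≡⟨ cong ((+ 2) ^_) (ℕ.m∸n+n≡m a≤b) ⟨
  (+ 2) ^ (b ℕ.∸ a ℕ.+ a)          ≡⟨ ^-distribˡ-+-* (+ 2) (b ℕ.∸ a) a ⟩
  (+ 2) ^ (b ℕ.∸ a) * (+ 2) ^ a    ∎)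

*-pres-2^∣ : ∀ a b {x y} → (+ 2) ^ a ∣ x → (+ 2) ^ b ∣ y → (+ 2) ^ (a ℕ.+ b) ∣ x * y
*-pres-2^∣ a b (divides p refl) (divides q refl) = divides (p * q)
  (trans (ring p ((+ 2) ^ a) q ((+ 2) ^ b)) (cong (p * q *_) (sym (^-distribˡ-+-* (+ 2) a b))))
  where
  ring : ∀ p a q b → p * a * (q * b) ≡ p * q * (a * b)
  ring = solve-∀

Odd : ℤ → Set
Odd x = ∃ λ p → x ≡ 1ℤ + + 2 * p

odd-* : ∀ {x y} → Odd x → Odd y → Odd (x * y)
odd-* (p , refl) (q , refl) = p + q + + 2 * (p * q) , ring p q
  where
  ring : ∀ p q → (1ℤ + + 2 * p) * (1ℤ + + 2 * q) ≡ 1ℤ + + 2 * (p + q + + 2 * (p * q))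
  ring = solve-∀

odd-suc-double : ∀ q → Odd (+ suc (q ℕ.* 2))
odd-suc-double q = + q , cong (_+_ 1ℤ) (trans (pos-* q 2) (ℤ.*-comm (+ q) (+ 2)))

odd-sub-even : ∀ {x y} → Odd x → + 2 ∣ y → Odd (y - x)
odd-sub-even (p , refl) (divides q refl) = q - p - 1ℤ , ring p q
  where
  ring : ∀ p q → q * + 2 - (1ℤ + + 2 * p) ≡ 1ℤ + + 2 * (q - p - 1ℤ)
  ring = solve-∀

¬2∣odd : ∀ {x} → Odd x → ¬ (+ 2 ∣ x)
¬2∣odd (p , refl) 2∣x with ℕ∣.∣⇒≤ (∣⇒∣ᵤ (∣m+n∣n⇒∣m {m = 1ℤ} 2∣x (∣m⇒∣m*n p ∣-refl)))
... | s≤s ()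

-- For o = 1 + 2p one has x = o x - 2 p x, so x is even when o x is; the induction halves both.
odd-cancel : ∀ e {o x} → Odd o → (+ 2) ^ e ∣ o * x → (+ 2) ^ e ∣ x
odd-cancel zero    {x = x} _ _ = divides x (sym (ℤ.*-identityʳ x))
odd-cancel (suc e) {x = x} (p , refl) (divides q eq) =
  subst ((+ 2) ^ suc e ∣_) (sym x≡2y) (*-monoʳ-∣ (+ 2)
    (odd-cancel e {x = y} (p , refl) (divides q (ℤ.*-cancelˡ-≡ (+ 2) _ _ 2oy≡))))
  where
  a = (+ 2) ^ e
  y = q * a - p * x
  ring₁ : ∀ p x → x ≡ (1ℤ + + 2 * p) * x - + 2 * (p * x)
  ring₁ = solve-∀
  ring₂ : ∀ q a b → q * (+ 2 * a) - + 2 * b ≡ + 2 * (q * a - b)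
  ring₂ = solve-∀
  ring₃ : ∀ p y → + 2 * ((1ℤ + + 2 * p) * y) ≡ (1ℤ + + 2 * p) * (+ 2 * y)
  ring₃ = solve-∀
  ring₄ : ∀ q a → q * (+ 2 * a) ≡ + 2 * (q * a)
  ring₄ = solve-∀
  x≡2y : x ≡ + 2 * y
  x≡2y = trans (ring₁ p x) (trans (cong (_- + 2 * (p * x)) eq) (ring₂ q a (p * x)))
  2oy≡ : + 2 * ((1ℤ + + 2 * p) * y) ≡ + 2 * (q * a)
  2oy≡ = trans (ring₃ p y) (trans (cong ((1ℤ + + 2 * p) *_) (sym x≡2y)) (trans eq (ring₄ q a)))

2^-cancel : ∀ a e {x} → (+ 2) ^ (a ℕ.+ e) ∣ (+ 2) ^ a * x → (+ 2) ^ e ∣ x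
2^-cancel a e {x} div = *-cancelˡ-∣ ((+ 2) ^ a) {{2^≢0 a}}
  (subst (_∣ (+ 2) ^ a * x) (^-distribˡ-+-* (+ 2) a e) div)

-- Cancelling a multiplier 2^a o with o odd costs a in the exponent. Valuations of factors are
-- compared through this rule, without subtraction.
strip : ∀ a e f {o x} → Odd o → a ℕ.+ f ℕ.≤ e → (+ 2) ^ e ∣ (+ 2) ^ a * o * x → (+ 2) ^ f ∣ x
strip a e f {o} {x} odd a+f≤e div = odd-cancel f odd (2^-cancel a f
  (∣-trans (2^-mono-∣ a+f≤e) (subst ((+ 2) ^ e ∣_) (ℤ.*-assoc ((+ 2) ^ a) o x) div)))

parity : ∀ n → ∃ λ q → n ≡ q ℕ.* 2 ⊎ n ≡ suc (q ℕ.* 2)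
parity zero    = 0 , inj₁ refl
parity (suc n) with parity n
... | q , inj₁ refl = q , inj₂ refl
... | q , inj₂ refl = suc q , inj₁ refl

odd-part : ∀ n → 1 ℕ.≤ n → ∃₂ λ a q → n ≡ 2 ℕ.^ a ℕ.* suc (q ℕ.* 2)
odd-part = <-rec _ step
  where
  step : ∀ n → (∀ {i} → i ℕ.< n → 1 ℕ.≤ i → ∃₂ λ a q → i ≡ 2 ℕ.^ a ℕ.* suc (q ℕ.* 2)) →
         1 ℕ.≤ n → ∃₂ λ a q → n ≡ 2 ℕ.^ a ℕ.* suc (q ℕ.* 2)
  step n rec 1≤n with parity n
  ... | q     , inj₂ refl = 0 , q , sym (ℕ.*-identityˡ _)
  ... | suc q , inj₁ refl with rec {suc q} (s≤s (s≤s (ℕ.m≤m*n q 2))) (s≤s z≤n)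
  ...   | a , p , eq = suc a , p , trans (ℕ.*-comm (suc q) 2) (trans (cong (2 ℕ.*_) eq) (sym (ℕ.*-assoc 2 (2 ℕ.^ a) _)))

pos-odd-part : ∀ a q → + (2 ℕ.^ a ℕ.* suc (q ℕ.* 2)) ≡ (+ 2) ^ a * + suc (q ℕ.* 2)
pos-odd-part a q = trans (pos-* (2 ℕ.^ a) _) (cong (_* + suc (q ℕ.* 2)) (pos-2^ a))

∣-neg : ∀ {d y} → d ∣ - y → d ∣ y
∣-neg {d} {y} dv = subst (d ∣_) (ℤ.neg-involutive y) (∣m⇒∣-m dv)

-- An odd multiplier does not change the valuation, and a congruence modulo 2^(e+1) with an odd
-- multiple of 2^e fixes it. The free `P` is what allows denominators to be cleared.
exact-valuation : ∀ e {P Q x} → Odd P → Odd Q → (+ 2) ^ suc e ∣ P * x - (+ 2) ^ e * Q → ν₂≡ x e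
exact-valuation e {P} {Q} {x} oddP oddQ div = divides-e , not-more
  where
  e⇒ : (+ 2) ^ e ∣ x
  e⇒ = odd-cancel e oddP (∣m+n∣n⇒∣m (∣-trans (2^-mono-∣ (ℕ.n≤1+n e)) div) (∣m⇒∣-m (∣m⇒∣m*n Q ∣-refl)))
  divides-e : (+ (2 ℕ.^ e)) ∣ᵤ.∣ x
  divides-e = ∣⇒∣ᵤ (subst (_∣ x) (sym (pos-2^ e)) e⇒)
  not-more : ¬ ((+ (2 ℕ.^ suc e)) ∣ᵤ.∣ x)
  not-more more = ¬2∣odd oddQ (subst (_∣ Q) (ℤ.*-identityʳ (+ 2)) (2^-cancel e 1 (subst (λ z → (+ 2) ^ z ∣ (+ 2) ^ e * Q) (ℕ.+-comm 1 e) (∣-neg (∣m+n∣m⇒∣n div (∣n⇒∣m*n P (subst (_∣ x) (pos-2^ (suc e)) (∣ᵤ⇒∣ more))))))))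

Σ<-∣ : ∀ {d} n {f} → (∀ i → i ℕ.< n → d ∣ f i) → d ∣ Σ< n f
Σ<-∣ zero    _   = divides 0ℤ refl
Σ<-∣ (suc n) div = ∣m∣n⇒∣m+n (div 0 (s≤s z≤n)) (Σ<-∣ n λ i i<n → div (suc i) (s≤s i<n))

Σ<-single : ∀ {d} n j f → j ℕ.< n → (∀ i → i ℕ.< n → ¬ i ≡ j → d ∣ f i) → d ∣ Σ< n f - f j
Σ<-single (suc n) zero f _ div = subst (_ ∣_) (ring (f 0) _)
  (Σ<-∣ n λ i i<n → div (suc i) (s≤s i<n) λ ())
  where
  ring : ∀ a b → b ≡ a + b - a
  ring = solve-∀
Σ<-single (suc n) (suc j) f (s≤s j<n) div = subst (_ ∣_) (sym (ℤ.+-assoc (f 0) _ _))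
  (∣m∣n⇒∣m+n (div 0 (s≤s z≤n) λ ()) (Σ<-single n j (f ∘ suc) j<n λ i i<n i≢j → div (suc i) (s≤s i<n) (i≢j ∘ ℕ.suc-injective)))

-- Divisibility of binomial coefficients

tC∣ : ∀ N t → + N ∣ + t * + (N C t)
tC∣ N       zero    = divides 0ℤ refl
tC∣ zero    (suc t) = subst (0ℤ ∣_) (sym (trans (cong (λ z → + suc t * + z) (k>n⇒nCk≡0 {0} {suc t} (s≤s z≤n))) (ℤ.*-zeroʳ (+ suc t)))) ∣-refl
tC∣ (suc N) (suc t) = divides (+ (N C t)) (trans (C-absorb-ℤ N t) (ℤ.*-comm (+ suc N) (+ (N C t))))

t2C∣ : ∀ N t → + N ∣ + t * + ((N ℕ.* 2) C t)
t2C∣ N t = ∣-trans (divides (+ 2) (trans (pos-* N 2) (ℤ.*-comm (+ N) (+ 2)))) (tC∣ (N ℕ.* 2) t)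

tD∣ : ∀ N t → + N ∣ + t * D N t
tD∣ N t = subst (+ N ∣_) (ring (+ t) _ _) (∣m∣n⇒∣m-n (t2C∣ N t) (tC∣ N t))
  where
  ring : ∀ t a b → t * a - t * b ≡ t * (a - b)
  ring = solve-∀

C-suc : ∀ N t → + suc t * + (N C suc t) ≡ (+ N - + t) * + (N C t)
C-suc N t = begin
  + suc t * + (N C suc t)
    ≡⟨ ring₁ (+ suc t) (+ (N C t)) (+ (N C suc t)) ⟩
  + suc t * (+ (N C t) + + (N C suc t)) - + suc t * + (N C t)
    ≡⟨ cong (λ z → + suc t * z - + suc t * + (N C t)) (trans (sym (pos-+ (N C t) _)) (cong +_ (nCk+nC[k+1]≡[n+1]C[k+1] N t))) ⟩
  + suc t * + (suc N C suc t) - + suc t * + (N C t)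
    ≡⟨ cong (_- + suc t * + (N C t)) (C-absorb-ℤ N t) ⟩
  + suc N * + (N C t) - + suc t * + (N C t)
    ≡⟨ ring₂ (+ N) (+ t) (+ (N C t)) ⟩
  (+ N - + t) * + (N C t) ∎
  where
  ring₁ : ∀ s a b → s * b ≡ s * (a + b) - s * a
  ring₁ = solve-∀
  ring₂ : ∀ n t a → (1ℤ + n) * a - (1ℤ + t) * a ≡ (n - t) * a
  ring₂ = solve-∀

-- Neighbours in row N add up to C(N+1, j+1). This is even, since 2^a divides (j+1) C(N+1, j+1)
-- while j+1 < 2^a has valuation below a; oddness thus spreads from C(N, 0) = 1.
C-odd : ∀ a c N j → suc N ≡ 2 ℕ.^ a ℕ.* c → j ℕ.< 2 ℕ.^ a → Odd (+ (N C j))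
C-odd a c N zero    _  _    = 0ℤ , refl
C-odd a c N (suc j) eq j<2^a = subst Odd difference
  (odd-sub-even (C-odd a c N j eq (ℕ.<-trans (ℕ.n<1+n j) j<2^a)) even)
  where
  difference : + (suc N C suc j) - + (N C j) ≡ + (N C suc j)
  difference = trans (cong (_- + (N C j)) (trans (cong +_ (sym (nCk+nC[k+1]≡[n+1]C[k+1] N j))) (pos-+ (N C j) (N C suc j)))) (ring (+ (N C j)) (+ (N C suc j)))
    where
    ring : ∀ x y → x + y - x ≡ y
    ring = solve-∀
  even : + 2 ∣ + (suc N C suc j)
  even with odd-part (suc j) (s≤s z≤n)
  ... | b , q , j≡ = subst (_∣ + (suc N C suc j)) (ℤ.*-identityʳ (+ 2)) (strip b a 1 (odd-suc-double q) b+1≤a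
    (subst ((+ 2) ^ a ∣_) (cong (_* + (suc N C suc j)) (trans (cong +_ j≡) (pos-odd-part b q)))
      (∣-trans 2^a∣ (tC∣ (suc N) (suc j)))))
    where
    2^a∣ : (+ 2) ^ a ∣ + suc N
    2^a∣ = divides (+ c) (trans (cong +_ eq) (trans (pos-* (2 ℕ.^ a) c) (trans (cong (_* + c) (pos-2^ a)) (ℤ.*-comm _ (+ c)))))
    b+1≤a : b ℕ.+ 1 ℕ.≤ a
    b+1≤a = subst (ℕ._≤ a) (ℕ.+-comm 1 b) (ℕ.≰⇒> λ a≤b → ℕ.<-irrefl refl (ℕ.<-≤-trans j<2^a
      (ℕ.≤-trans (ℕ.^-monoʳ-≤ 2 a≤b) (subst (2 ℕ.^ b ℕ.≤_) (sym j≡) (ℕ.m≤m*n (2 ℕ.^ b) (suc (q ℕ.* 2)))))))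

-- Terms of high valuation

n<2^n : ∀ n → n ℕ.< 2 ℕ.^ n
n<2^n zero    = s≤s z≤n
n<2^n (suc n) = subst (ℕ._≤ 2 ℕ.^ suc n) (ℕ.+-comm (suc n) 1)
  (ℕ.+-mono-≤ (n<2^n n) (ℕ.≤-trans (ℕ.m^n>0 2 n) (ℕ.m≤m+n _ 0)))

d[4+d]<4*2^d : ∀ d → d ℕ.* (4 ℕ.+ d) ℕ.< 4 ℕ.* 2 ℕ.^ d
d[4+d]<4*2^d 0 = s≤s z≤n
d[4+d]<4*2^d 1 = ℕ.m≤m+n 6 2
d[4+d]<4*2^d 2 = ℕ.m≤m+n 13 3
-- Doubling the bound is enough only from d = 2 on: (d+1)(d+5) ≤ 2d(d+4) fails at d = 1, hence three
-- base cases.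
d[4+d]<4*2^d (suc (suc (suc d))) = step d (d[4+d]<4*2^d (suc (suc d)))
  where
  step : ∀ d → let x = (2 ℕ.+ d) ℕ.* (6 ℕ.+ d) in
         x ℕ.< 4 ℕ.* 2 ℕ.^ (2 ℕ.+ d) → (3 ℕ.+ d) ℕ.* (7 ℕ.+ d) ℕ.< 4 ℕ.* 2 ℕ.^ (3 ℕ.+ d)
  step d ih = ℕ.≤-<-trans
    (subst ((3 ℕ.+ d) ℕ.* (7 ℕ.+ d) ℕ.≤_) (ring₁ d) (ℕ.m≤m+n ((3 ℕ.+ d) ℕ.* (7 ℕ.+ d)) _))
    (subst ((2 ℕ.+ d) ℕ.* (6 ℕ.+ d) ℕ.+ (2 ℕ.+ d) ℕ.* (6 ℕ.+ d) ℕ.<_) (ring₂ (2 ℕ.^ d)) (ℕ.+-mono-< ih ih))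
    where
    ring₁ : ∀ d → (3 ℕ.+ d) ℕ.* (7 ℕ.+ d) ℕ.+ (3 ℕ.+ 6 ℕ.* d ℕ.+ d ℕ.* d) ≡ (2 ℕ.+ d) ℕ.* (6 ℕ.+ d) ℕ.+ (2 ℕ.+ d) ℕ.* (6 ℕ.+ d)
    ring₁ = ℕ-Solver.solve-∀
    ring₂ : ∀ p → 4 ℕ.* (2 ℕ.* (2 ℕ.* p)) ℕ.+ 4 ℕ.* (2 ℕ.* (2 ℕ.* p)) ≡ 4 ℕ.* (2 ℕ.* (2 ℕ.* (2 ℕ.* p)))
    ring₂ = ℕ-Solver.solve-∀

-- The case h = 4 plus h-4 copies of d < 2^d. For h = 2 both sides are 8 at d = 2.
d[h+d]<h*2^d : ∀ h d → 4 ℕ.≤ h → d ℕ.* (h ℕ.+ d) ℕ.< h ℕ.* 2 ℕ.^ d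
d[h+d]<h*2^d h d 4≤h = subst (λ h → d ℕ.* (h ℕ.+ d) ℕ.< h ℕ.* 2 ℕ.^ d) (ℕ.m+[n∸m]≡n 4≤h)
  (subst₂ ℕ._<_ (ring d j) (sym (ℕ.*-distribʳ-+ (2 ℕ.^ d) 4 j))
    (ℕ.+-mono-<-≤ (d[4+d]<4*2^d d) (ℕ.*-monoʳ-≤ j (ℕ.<⇒≤ (n<2^n d)))))
  where
  j = h ℕ.∸ 4
  ring : ∀ d j → d ℕ.* (4 ℕ.+ d) ℕ.+ j ℕ.* d ≡ d ℕ.* (4 ℕ.+ j ℕ.+ d)
  ring = ℕ-Solver.solve-∀

-- The smaller of 2^a, 2^b divides the gap d, the larger is at most h + d.
valuations-apart : ∀ M {q d a b} → 2 ℕ.≤ M → 1 ℕ.≤ q → q ℕ.≤ 2 ℕ.^ M → 1 ℕ.≤ d →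
  2 ℕ.^ a ℕ∣.∣ q → 2 ℕ.^ b ℕ∣.∣ q ℕ.+ d → a ℕ.+ b ℕ.< M ℕ.+ d
valuations-apart M {suc q} {suc d} {a} {b} 2≤M _ q≤h _ a∣q b∣q+d = ℕ.≰⇒> λ M+d≤a+b → ℕ.<-irrefl refl
  (ℕ.≤-<-trans (ℕ.^-monoʳ-≤ 2 M+d≤a+b) (ℕ.≤-<-trans 2^[a+b]≤
    (subst (suc d ℕ.* (2 ℕ.^ M ℕ.+ suc d) ℕ.<_) (sym (ℕ.^-distribˡ-+-* 2 M (suc d)))
      (d[h+d]<h*2^d (2 ℕ.^ M) (suc d) (ℕ.^-monoʳ-≤ 2 2≤M)))))
  where
  2^∣ : ∀ {x y} → x ℕ.≤ y → 2 ℕ.^ x ℕ∣.∣ 2 ℕ.^ y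
  2^∣ {x} {y} x≤y = ℕ∣.divides (2 ℕ.^ (y ℕ.∸ x)) (trans (cong (2 ℕ.^_) (sym (ℕ.m∸n+n≡m x≤y))) (ℕ.^-distribˡ-+-* 2 (y ℕ.∸ x) x))
  2^[a+b]≤ : 2 ℕ.^ (a ℕ.+ b) ℕ.≤ suc d ℕ.* (2 ℕ.^ M ℕ.+ suc d)
  2^[a+b]≤ with ℕ.≤-total a b
  ... | inj₁ a≤b = subst (ℕ._≤ _) (sym (ℕ.^-distribˡ-+-* 2 a b)) (ℕ.*-mono-≤
    (ℕ∣.∣⇒≤ (ℕ∣.∣m+n∣m⇒∣n (ℕ∣.∣-trans (2^∣ a≤b) b∣q+d) a∣q))
    (ℕ.≤-trans (ℕ∣.∣⇒≤ b∣q+d) (ℕ.+-monoˡ-≤ (suc d) q≤h)))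
  ... | inj₂ b≤a = subst (ℕ._≤ _) (trans (ℕ.*-comm (2 ℕ.^ b) (2 ℕ.^ a)) (sym (ℕ.^-distribˡ-+-* 2 a b))) (ℕ.*-mono-≤
    (ℕ∣.∣⇒≤ (ℕ∣.∣m+n∣m⇒∣n b∣q+d (ℕ∣.∣-trans (2^∣ b≤a) a∣q)))
    (ℕ.≤-trans (ℕ∣.∣⇒≤ a∣q) (ℕ.≤-trans q≤h (ℕ.m≤m+n _ _))))

-- Applied with q = r+1 and `x` = D_t for t = q+d, so that 2^(d+1) is the power 2^(t-r). If a and b
-- are the valuations of q and t, then `κ` keeps M-a factors of 2 and `x` keeps n-b; a+b < M+d
-- leaves n+2 in total.
tail-divisible : ∀ M n {q d κ x} → 2 ℕ.≤ M → 1 ℕ.≤ q → q ℕ.≤ 2 ℕ.^ M → 1 ℕ.≤ d →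
  (+ 2) ^ M ∣ + q * κ → (+ 2) ^ n ∣ + (q ℕ.+ d) * x → (+ 2) ^ (n ℕ.+ 2) ∣ (+ 2) ^ suc d * (κ * x)
tail-divisible M n {q} {d} {κ} {x} 2≤M 1≤q q≤h 1≤d κ∣ x∣
  with odd-part q 1≤q | odd-part (q ℕ.+ d) (ℕ.≤-trans 1≤q (ℕ.m≤m+n q d))
... | a , u , q≡ | b , v , t≡ = strip (a ℕ.+ b) (M ℕ.+ n ℕ.+ suc d) (n ℕ.+ 2)
  (odd-* (odd-suc-double u) (odd-suc-double v)) exponents
  (subst ((+ 2) ^ (M ℕ.+ n ℕ.+ suc d) ∣_) rearranged
    (*-pres-2^∣ (M ℕ.+ n) (suc d) (*-pres-2^∣ M n κ∣ x∣) ∣-refl))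
  where
  apart : a ℕ.+ b ℕ.< M ℕ.+ d
  apart = valuations-apart M {q} {d} {a} {b} 2≤M 1≤q q≤h 1≤d (ℕ∣.divides (suc (u ℕ.* 2)) (trans q≡ (ℕ.*-comm (2 ℕ.^ a) _)))
    (ℕ∣.divides (suc (v ℕ.* 2)) (trans t≡ (ℕ.*-comm (2 ℕ.^ b) _)))
  exponents : a ℕ.+ b ℕ.+ (n ℕ.+ 2) ℕ.≤ M ℕ.+ n ℕ.+ suc d
  exponents = subst₂ ℕ._≤_ (ring₁ (a ℕ.+ b) n) (ring₂ M d n) (ℕ.+-monoˡ-≤ (suc n) apart)
    where
    ring₁ : ∀ a n → suc a ℕ.+ suc n ≡ a ℕ.+ (n ℕ.+ 2)
    ring₁ = ℕ-Solver.solve-∀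
    ring₂ : ∀ M d n → M ℕ.+ d ℕ.+ suc n ≡ M ℕ.+ n ℕ.+ suc d
    ring₂ = ℕ-Solver.solve-∀
  ring : ∀ A o κ B o′ x e → A * o * κ * (B * o′ * x) * e ≡ A * B * (o * o′) * (e * (κ * x))
  ring = solve-∀
  rearranged : + q * κ * (+ (q ℕ.+ d) * x) * (+ 2) ^ suc d
    ≡ (+ 2) ^ (a ℕ.+ b) * (+ suc (u ℕ.* 2) * + suc (v ℕ.* 2)) * ((+ 2) ^ suc d * (κ * x))
  rearranged = begin
    + q * κ * (+ (q ℕ.+ d) * x) * (+ 2) ^ suc d
      ≡⟨ cong₂ (λ y z → y * κ * (z * x) * (+ 2) ^ suc d)
           (trans (cong +_ q≡) (pos-odd-part a u)) (trans (cong +_ t≡) (pos-odd-part b v)) ⟩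
    (+ 2) ^ a * + suc (u ℕ.* 2) * κ * ((+ 2) ^ b * + suc (v ℕ.* 2) * x) * (+ 2) ^ suc d
      ≡⟨ ring ((+ 2) ^ a) (+ suc (u ℕ.* 2)) κ ((+ 2) ^ b) (+ suc (v ℕ.* 2)) x ((+ 2) ^ suc d) ⟩
    (+ 2) ^ a * (+ 2) ^ b * (+ suc (u ℕ.* 2) * + suc (v ℕ.* 2)) * ((+ 2) ^ suc d * (κ * x))
      ≡⟨ cong (λ z → z * (+ suc (u ℕ.* 2) * + suc (v ℕ.* 2)) * ((+ 2) ^ suc d * (κ * x))) (^-distribˡ-+-* (+ 2) a b) ⟨
    (+ 2) ^ (a ℕ.+ b) * (+ suc (u ℕ.* 2) * + suc (v ℕ.* 2)) * ((+ 2) ^ suc d * (κ * x)) ∎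

-- Reduction of each term modulo 2^(n+2)

-- The left side is the t = r and t = r+1 part of `Y`. By `C-suc`, (r+1) D_(r+1) is -r D_r up to
-- multiples of N.
leading-pair : ∀ N r → D N r + + r * (+ suc r * D N (suc r)) ≡
  (1ℤ - + r * + r) * D N r + + N * (+ 2 * (+ r * + ((N ℕ.* 2) C r)) - + r * + (N C r))
leading-pair N r = begin
  D N r + + r * (+ suc r * D N (suc r))
    ≡⟨ cong (λ z → D N r + + r * z) (ring₁ (+ suc r) (+ ((N ℕ.* 2) C suc r)) (+ (N C suc r))) ⟩
  D N r + + r * (+ suc r * + ((N ℕ.* 2) C suc r) - + suc r * + (N C suc r))
    ≡⟨ cong₂ (λ y z → D N r + + r * (y - z)) (trans (C-suc (N ℕ.* 2) r) (cong (λ z → (z - + r) * + ((N ℕ.* 2) C r)) (pos-* N 2))) (C-suc N r) ⟩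
  D N r + + r * ((+ N * + 2 - + r) * + ((N ℕ.* 2) C r) - (+ N - + r) * + (N C r))
    ≡⟨ ring₂ (+ N) (+ r) (+ ((N ℕ.* 2) C r)) (+ (N C r)) ⟩
  (1ℤ - + r * + r) * D N r + + N * (+ 2 * (+ r * + ((N ℕ.* 2) C r)) - + r * + (N C r)) ∎
  where
  ring₁ : ∀ s a b → s * (a - b) ≡ s * a - s * b
  ring₁ = solve-∀
  ring₂ : ∀ N r a b → a - b + r * ((N * + 2 - r) * a - (N - r) * b) ≡ (1ℤ - r * r) * (a - b) + N * (+ 2 * (r * a) - r * b)
  ring₂ = solve-∀

Y-split : ∀ N r L → suc (N ℕ.* 2) ℕ.∸ r ≡ 2 ℕ.+ L →
  Y N r ≡ D N r + + r * (+ suc r * D N (suc r)) +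
          Σ< L (λ b → D N (suc r ℕ.+ suc b) * ((+ 2) ^ (2 ℕ.+ b) * + S (suc r ℕ.+ suc b) r))
Y-split N r L eq = begin
  Y N r
    ≡⟨ cong (λ z → Σ< z y) eq ⟩
  y 0 + (y 1 + Σ< L (λ b → y (2 ℕ.+ b)))
    ≡⟨ sym (ℤ.+-assoc (y 0) (y 1) _) ⟩
  y 0 + y 1 + Σ< L (λ b → y (2 ℕ.+ b))
    ≡⟨ cong₂ _+_ (cong₂ _+_ y0 y1) (Σ<-cong L λ b → cong (λ t → D N t * ((+ 2) ^ (2 ℕ.+ b) * + S t r)) (ℕ.+-suc r (suc b))) ⟩
  D N r + + r * (+ suc r * D N (suc r)) + Σ< L (λ b → D N (suc r ℕ.+ suc b) * ((+ 2) ^ (2 ℕ.+ b) * + S (suc r ℕ.+ suc b) r)) ∎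
  where
  y : ℕ → ℤ
  y b = D N (r ℕ.+ b) * ((+ 2) ^ b * + S (r ℕ.+ b) r)
  y0 : y 0 ≡ D N r
  y0 = trans (cong (λ t → D N t * (1ℤ * + S t r)) (ℕ.+-identityʳ r))
    (trans (cong (λ z → D N r * (1ℤ * + z)) (S-diag r)) (ℤ.*-identityʳ (D N r)))
  ring : ∀ d r s → d * (r * s) ≡ r * (s * d)
  ring = solve-∀
  y1 : y 1 ≡ + r * (+ suc r * D N (suc r))
  y1 = trans (cong (λ t → D N t * ((+ 2) ^ 1 * + S t r)) (trans (ℕ.+-suc r 0) (cong suc (ℕ.+-identityʳ r))))
    (trans (cong (D N (suc r) *_) (trans (sym (pos-* 2 (S (suc r) r))) (trans (cong +_ (S-subdiag r)) (pos-* r (suc r)))))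
      (ring (D N (suc r)) (+ r) (+ suc r)))

term-congruence : ∀ M n N r κ → 2 ℕ.≤ M → 2 ℕ.≤ n → r ℕ.< 2 ℕ.^ M → r ℕ.< N →
  (+ 2) ^ n ∣ + N → (+ 2) ^ M ∣ + suc r * κ →
  (+ 2) ^ (n ℕ.+ 2) ∣ κ * Y N r - κ * ((1ℤ - + r * + r) * D N r)
term-congruence M n N r κ 2≤M 2≤n r<h r<N n∣N κ∣ = subst ((+ 2) ^ (n ℕ.+ 2) ∣_) (sym expansion)
  (∣m∣n⇒∣m+n (∣n⇒∣m*n κ second) (subst ((+ 2) ^ (n ℕ.+ 2) ∣_) (Σ<-* L κ tail) (Σ<-∣ L λ b _ → tail∣ b)))
  where
  L = suc (N ℕ.* 2) ℕ.∸ r ℕ.∸ 2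
  tail : ℕ → ℤ
  tail b = D N (suc r ℕ.+ suc b) * ((+ 2) ^ (2 ℕ.+ b) * + S (suc r ℕ.+ suc b) r)
  rest = + N * (+ 2 * (+ r * + ((N ℕ.* 2) C r)) - + r * + (N C r))
  long : 2 ℕ.≤ suc (N ℕ.* 2) ℕ.∸ r
  long = ℕ.m+n≤o⇒m≤o∸n 2 (s≤s (ℕ.≤-trans r<N (ℕ.m≤m*n N 2)))
  expansion : κ * Y N r - κ * ((1ℤ - + r * + r) * D N r) ≡ κ * rest + κ * Σ< L tail
  expansion = begin
    κ * Y N r - κ * ((1ℤ - + r * + r) * D N r)
      ≡⟨ cong (λ z → κ * z - κ * ((1ℤ - + r * + r) * D N r)) (trans (Y-split N r L (sym (ℕ.m+[n∸m]≡n long))) (cong (_+ Σ< L tail) (leading-pair N r))) ⟩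
    κ * ((1ℤ - + r * + r) * D N r + rest + Σ< L tail) - κ * ((1ℤ - + r * + r) * D N r)
      ≡⟨ ring κ ((1ℤ - + r * + r) * D N r) rest (Σ< L tail) ⟩
    κ * rest + κ * Σ< L tail ∎
    where
    ring : ∀ κ a b c → κ * (a + b + c) - κ * a ≡ κ * b + κ * c
    ring = solve-∀
  -- Besides the outer N, each summand contains r C(2N, r) or r C(N, r), again a multiple of N; 2n ≥
  -- n+2 then suffices.
  second : (+ 2) ^ (n ℕ.+ 2) ∣ rest
  second = ∣-trans (2^-mono-∣ (ℕ.+-monoʳ-≤ n 2≤n)) (*-pres-2^∣ n n n∣N
    (∣m∣n⇒∣m-n (∣n⇒∣m*n (+ 2) (∣-trans n∣N (t2C∣ N r))) (∣-trans n∣N (tC∣ N r))))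
  tail∣ : ∀ b → (+ 2) ^ (n ℕ.+ 2) ∣ κ * tail b
  tail∣ b = subst ((+ 2) ^ (n ℕ.+ 2) ∣_) (ring κ (D N (suc r ℕ.+ suc b)) ((+ 2) ^ (2 ℕ.+ b)) (+ S (suc r ℕ.+ suc b) r))
    (∣m⇒∣m*n (+ S (suc r ℕ.+ suc b) r) (tail-divisible M n {suc r} {suc b} {κ} {D N (suc r ℕ.+ suc b)} 2≤M (s≤s z≤n) r<h (s≤s z≤n) κ∣
      (∣-trans n∣N (tD∣ N (suc r ℕ.+ suc b)))))
    where
    ring : ∀ κ d p s → p * (κ * d) * s ≡ κ * (d * (p * s))
    ring = solve-∀

leading-odd : ∀ n N r κ → Odd (+ r) → (+ 2) ^ n ∣ + N →
  (+ 2) ^ (n ℕ.+ 2) ∣ κ * ((1ℤ - + r * + r) * D N r)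
leading-odd n N r κ odd@(p , r≡) n∣N = ∣n⇒∣m*n κ (subst (λ z → (+ 2) ^ z ∣ (1ℤ - + r * + r) * D N r) (ℕ.+-comm 2 n)
  (*-pres-2^∣ 2 n 4∣ (odd-cancel n odd (∣-trans n∣N (tD∣ N r)))))
  where
  ring : ∀ p → 1ℤ - (1ℤ + + 2 * p) * (1ℤ + + 2 * p) ≡ - (p + p * p) * + 4
  ring = solve-∀
  4∣ : (+ 2) ^ 2 ∣ 1ℤ - + r * + r
  4∣ = divides (- (p + p * p)) (trans (cong (λ z → 1ℤ - z * z) r≡) (ring p))

-- Here h = 2^(M+1). As r+1 is odd, `κ` carries all of h, while D_r carries at least 2^n divided by
-- the 2-part of r. This falls short only if 2^M divides r, which for 0 < r < h means r = h/2; and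
-- D_0 = 0.
leading-even : ∀ M n N r κ → r ℕ.< 2 ℕ.^ suc M → ¬ r ≡ 2 ℕ.^ M → Odd (+ suc r) → (+ 2) ^ n ∣ + N →
  (+ 2) ^ suc M ∣ + suc r * κ → (+ 2) ^ (n ℕ.+ 2) ∣ κ * ((1ℤ - + r * + r) * D N r)
leading-even M n N zero κ _ _ _ _ _ = divides 0ℤ (ring κ)
  where
  ring : ∀ κ → κ * ((1ℤ - 0ℤ * 0ℤ) * 0ℤ) ≡ 0ℤ
  ring = solve-∀
leading-even M n N r@(suc _) κ r<h r≢g odd n∣N κ∣ with odd-part r (s≤s z≤n)
... | a , q , r≡ = subst ((+ 2) ^ (n ℕ.+ 2) ∣_) (ring₁ (1ℤ - + r * + r) κ (D N r)) (∣n⇒∣m*n (1ℤ - + r * + r)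
  (strip a (suc M ℕ.+ n) (n ℕ.+ 2) (odd-suc-double q)
    (subst₂ ℕ._≤_ (ring₂ a n) (cong suc (ℕ.+-comm n M)) (ℕ.+-monoʳ-≤ (suc n) (a<M q r≡)))
    (subst ((+ 2) ^ (suc M ℕ.+ n) ∣_) (trans (ring₃ κ (+ r) (D N r)) (cong (_* (κ * D N r)) (trans (cong +_ r≡) (pos-odd-part a q))))
      (*-pres-2^∣ (suc M) n (odd-cancel (suc M) odd κ∣) (∣-trans n∣N (tD∣ N r))))))
  where
  ring₁ : ∀ e κ d → e * (κ * d) ≡ κ * (e * d)
  ring₁ = solve-∀
  ring₂ : ∀ a n → suc n ℕ.+ suc a ≡ a ℕ.+ (n ℕ.+ 2)
  ring₂ = ℕ-Solver.solve-∀
  ring₃ : ∀ κ r d → κ * (r * d) ≡ r * (κ * d)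
  ring₃ = solve-∀
  a<M : ∀ q → r ≡ 2 ℕ.^ a ℕ.* suc (q ℕ.* 2) → a ℕ.< M
  a<M zero    r≡ = ℕ.≤∧≢⇒< (ℕ.≤-pred (ℕ.≰⇒> λ M<a → ℕ.<-irrefl refl (ℕ.<-≤-trans (subst (ℕ._< 2 ℕ.^ suc M) r≡2^a r<h) (ℕ.^-monoʳ-≤ 2 M<a))))
    (λ a≡M → r≢g (trans r≡2^a (cong (2 ℕ.^_) a≡M)))
    where
    r≡2^a = trans r≡ (ℕ.*-identityʳ (2 ℕ.^ a))
  a<M (suc q) r≡ = ℕ.≰⇒> λ M≤a → ℕ.<-irrefl refl (ℕ.<-≤-trans r<h (ℕ.≤-trans (ℕ.^-monoʳ-≤ 2 (s≤s M≤a))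
    (subst₂ ℕ._≤_ (ℕ.*-comm (2 ℕ.^ a) 2) (sym r≡) (ℕ.*-monoʳ-≤ (2 ℕ.^ a) (s≤s (s≤s (z≤n {suc (q ℕ.* 2)})))))))

-- The coefficients C(H + s, H) with r + s = H and H + 1 = 2^M

-- For H = r+s, r+1 = 2(H+1) - (H+s+1), and absorption turns (H+s+1) C(H+s, H) into a multiple of
-- H+1.
coefficient-divisible : ∀ M r s → suc (r ℕ.+ s) ≡ 2 ℕ.^ M →
  (+ 2) ^ M ∣ + suc r * + ((r ℕ.+ s ℕ.+ s) C (r ℕ.+ s))
coefficient-divisible M r s h≡ = subst ((+ 2) ^ M ∣_) (sym expansion)
  (∣m∣n⇒∣m-n (∣m⇒∣m*n κ (∣n⇒∣m*n (+ 2) h∣)) (∣m⇒∣m*n C′ h∣))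
  where
  H = r ℕ.+ s
  κ = + ((H ℕ.+ s) C H)
  C′ = + (suc (H ℕ.+ s) C suc H)
  h∣ : (+ 2) ^ M ∣ + suc H
  h∣ = ∣-reflexive (trans (sym (pos-2^ M)) (cong +_ (sym h≡)))
  ring : ∀ r s κ → (1ℤ + r) * κ ≡ + 2 * (1ℤ + (r + s)) * κ - (1ℤ + (r + s + s)) * κ
  ring = solve-∀
  expansion : + suc r * κ ≡ + 2 * + suc H * κ - + suc H * C′
  expansion = begin
    + suc r * κ
      ≡⟨ ring (+ r) (+ s) κ ⟩
    + 2 * + suc H * κ - + suc (H ℕ.+ s) * κ
      ≡⟨ cong (λ z → + 2 * + suc H * κ - z) (sym (C-absorb-ℤ (H ℕ.+ s) H)) ⟩
    + 2 * + suc H * κ - + suc H * C′ ∎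

-- This is r = g = h/2 = s+1, with `suc N` in the role of N. Absorption gives w κ = 2g C′ and g D_g
-- = N e; the factors g cancel and leave 2N times the odd numbers C′ and e.
main-term : ∀ M n c s N → 1 ℕ.≤ M → M ℕ.≤ n → suc s ≡ 2 ℕ.^ M → suc N ≡ 2 ℕ.^ n ℕ.* c → Odd (+ c) →
  let H = suc s ℕ.+ s in
  ∃₂ λ w Q → Odd w × Odd Q × w * (+ ((H ℕ.+ s) C H) * D (suc N) (suc s)) ≡ (+ 2) ^ suc n * Q
main-term (suc M) n c s N _ M≤n g≡ N≡ oddc =
  w , + c * (C′ * e) , odd-w , odd-* oddc (odd-* odd-C′ odd-e) ,
  ℤ.*-cancelˡ-≡ (+ suc s) _ _ (begin
    + suc s * (w * (κ * d))
      ≡⟨ ring₁ (+ suc s) w κ d ⟩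
    w * κ * (+ suc s * d)
      ≡⟨ cong₂ _*_ wκ≡ gd≡ ⟩
    + 2 * + suc s * C′ * (+ suc N * e)
      ≡⟨ cong (λ z → + 2 * + suc s * C′ * (z * e)) (trans (cong +_ N≡) (trans (pos-* (2 ℕ.^ n) c) (cong (_* + c) (pos-2^ n)))) ⟩
    + 2 * + suc s * C′ * ((+ 2) ^ n * + c * e)
      ≡⟨ ring₂ (+ suc s) C′ ((+ 2) ^ n) (+ c) e ⟩
    + suc s * ((+ 2) ^ suc n * (+ c * (C′ * e))) ∎)
  where
  H = suc s ℕ.+ s
  κ = + ((H ℕ.+ s) C H)
  d = D (suc N) (suc s)
  w = + suc (H ℕ.+ s)
  C′ = + (suc (H ℕ.+ s) C suc H)
  e = + 2 * + (suc (N ℕ.* 2) C s) - + (N C s)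
  ring₁ : ∀ g w κ d → g * (w * (κ * d)) ≡ w * κ * (g * d)
  ring₁ = solve-∀
  ring₂ : ∀ g C p c e → + 2 * g * C * (p * c * e) ≡ g * (+ 2 * p * (c * (C * e)))
  ring₂ = solve-∀
  wκ≡ : w * κ ≡ + 2 * + suc s * C′
  wκ≡ = begin
    w * κ             ≡⟨ sym (C-absorb-ℤ (H ℕ.+ s) H) ⟩
    + suc H * C′      ≡⟨ cong (_* C′) (ring (+ s)) ⟩
    + 2 * + suc s * C′ ∎
    where
    ring : ∀ s → 1ℤ + (1ℤ + s + s) ≡ + 2 * (1ℤ + s)
    ring = solve-∀
  gd≡ : + suc s * d ≡ + suc N * e
  gd≡ = begin
    + suc s * (+ (suc N ℕ.* 2 C suc s) - + (suc N C suc s))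
      ≡⟨ distrib (+ suc s) (+ (suc N ℕ.* 2 C suc s)) (+ (suc N C suc s)) ⟩
    + suc s * + (suc N ℕ.* 2 C suc s) - + suc s * + (suc N C suc s)
      ≡⟨ cong₂ _-_ (C-absorb-ℤ (suc (N ℕ.* 2)) s) (C-absorb-ℤ N s) ⟩
    + (suc N ℕ.* 2) * + (suc (N ℕ.* 2) C s) - + suc N * + (N C s)
      ≡⟨ cong (λ z → z * + (suc (N ℕ.* 2) C s) - + suc N * + (N C s)) (pos-* (suc N) 2) ⟩
    + suc N * + 2 * + (suc (N ℕ.* 2) C s) - + suc N * + (N C s)
      ≡⟨ factor (+ suc N) (+ (suc (N ℕ.* 2) C s)) (+ (N C s)) ⟩
    + suc N * e ∎
    where
    distrib : ∀ s a b → s * (a - b) ≡ s * a - s * b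
    distrib = solve-∀
    factor : ∀ n a b → n * + 2 * a - n * b ≡ n * (+ 2 * a - b)
    factor = solve-∀
  odd-w : Odd w
  odd-w = + 3 * (+ 2) ^ M - 1ℤ , trans (ring (+ s)) (trans (cong (λ z → + 3 * z - 1ℤ) (trans (cong +_ g≡) (pos-2^ (suc M)))) (ring′ ((+ 2) ^ M)))
    where
    ring : ∀ s → 1ℤ + (1ℤ + s + s + s) ≡ + 3 * (1ℤ + s) - 1ℤ
    ring = solve-∀
    ring′ : ∀ x → + 3 * (+ 2 * x) - 1ℤ ≡ 1ℤ + + 2 * (+ 3 * x - 1ℤ)
    ring′ = solve-∀
  odd-C′ : Odd C′
  -- C(3g-1, 2g) = C(3g-1, g-1), and 3g = 3 * 2^M for the outer exponent M; this is the origin of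
  -- the argument 3.
  odd-C′ = subst (λ z → Odd (+ z)) (sym C-sym) (C-odd (suc M) 3 (suc (H ℕ.+ s)) s
    (trans (ring s) (cong (ℕ._* 3) g≡)) (subst (s ℕ.<_) g≡ (ℕ.n<1+n s)))
    where
    ring : ∀ s → suc (suc (suc s ℕ.+ s ℕ.+ s)) ≡ suc s ℕ.* 3
    ring = ℕ-Solver.solve-∀
    C-sym : suc (H ℕ.+ s) C suc H ≡ suc (H ℕ.+ s) C s
    C-sym = trans (nCk≡nC[n∸k] (ℕ.m≤m+n (suc H) s)) (cong (suc (H ℕ.+ s) C_) (ℕ.m+n∸m≡n (suc H) s))
  odd-e : Odd e
  odd-e = odd-sub-even (C-odd n c N s N≡ (ℕ.<-≤-trans (ℕ.n<1+n s) (subst (ℕ._≤ 2 ℕ.^ n) (sym g≡) (ℕ.^-monoʳ-≤ 2 M≤n))))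
    (∣m⇒∣m*n (+ (suc (N ℕ.* 2) C s)) ∣-refl)

-- The contribution of the even points

odds-0  : ∀ k → odds  k (λ _ → 0ℤ) ≡ 0ℤ
evens-0 : ∀ k → evens k (λ _ → 0ℤ) ≡ 0ℤ
odds-0  zero    = refl
odds-0  (suc k) = cong₂ _+_ (odds-0 k) (evens-0 k)
evens-0 zero    = refl
evens-0 (suc k) = cong₂ _+_ (evens-0 k) (odds-0 k)

evens-* : ∀ k c f → evens k (λ i → c * f i) ≡ c * evens k f
evens-* k c f = begin
  evens k (λ i → c * f i)                ≡⟨ evens-cong k (λ i → sym (ℤ.+-identityˡ (c * f i))) ⟩
  evens k (λ i → 0ℤ + c * f i)           ≡⟨ evens-linear k c (λ _ → 0ℤ) f ⟩
  evens k (λ _ → 0ℤ) + c * evens k f     ≡⟨ cong (_+ c * evens k f) (evens-0 k) ⟩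
  0ℤ + c * evens k f                     ≡⟨ ℤ.+-identityˡ _ ⟩
  c * evens k f                          ∎

2∣odds-1 : ∀ k → + 2 ∣ odds (suc (suc k)) (λ _ → 1ℤ)
2∣odds-1 k = subst (+ 2 ∣_) (sym (odds-rec k (λ _ → 1ℤ)))
  (∣m∣n⇒∣m+n (∣m⇒∣m*n (odds (suc k) (λ _ → 1ℤ)) ∣-refl) (subst (+ 2 ∣_) (sym (odds-0 k)) (divides 0ℤ refl)))

2∣odds-id : ∀ k → + 2 ∣ odds (4 ℕ.+ k) (+_)
2∣odds-id k = subst (+ 2 ∣_) (sym (odds-rec (2 ℕ.+ k) (+_)))
  (∣m∣n⇒∣m+n (∣m⇒∣m*n (odds (3 ℕ.+ k) (+_)) ∣-refl) (subst (+ 2 ∣_) (odds-cong (2 ℕ.+ k) λ i → ring (+ i)) (2∣odds-1 k)))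
  where
  ring : ∀ i → 1ℤ ≡ 1ℤ + i - i
  ring = solve-∀

2∣evens-id : ∀ k → + 2 ∣ evens (4 ℕ.+ k) (+_)
2∣evens-id k = ∣m+n∣m⇒∣n (2∣odds-id (suc k)) (2∣odds-id k)

2∣x^n-x : ∀ n i → + 2 ∣ (+ i) ^ suc n - + i
2∣x^n-x zero    i = divides 0ℤ (ring (+ i))
  where
  ring : ∀ x → x * 1ℤ - x ≡ 0ℤ
  ring = solve-∀
2∣x^n-x (suc n) i = subst (+ 2 ∣_) (ring (+ i) ((+ i) ^ suc n))
  (∣m∣n⇒∣m+n (∣n⇒∣m*n (+ i) (2∣x^n-x n i)) square)
  where
  ring : ∀ x p → x * (p - x) + (x * x - x) ≡ x * p - x
  ring = solve-∀
  square : + 2 ∣ + i * + i - + i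
  square with parity i
  ... | q , inj₁ refl = divides (+ 2 * + q * + q - + q) (trans (cong (λ z → z * z - z) (pos-* q 2)) (ring₀ (+ q)))
    where
    ring₀ : ∀ q → q * + 2 * (q * + 2) - q * + 2 ≡ (+ 2 * q * q - q) * + 2
    ring₀ = solve-∀
  ... | q , inj₂ refl = divides (+ 2 * + q * + q + + q) (trans (cong (λ z → (1ℤ + z) * (1ℤ + z) - (1ℤ + z)) (pos-* q 2)) (ring₁ (+ q)))
    where
    ring₁ : ∀ q → (1ℤ + q * + 2) * (1ℤ + q * + 2) - (1ℤ + q * + 2) ≡ (+ 2 * q * q + q) * + 2
    ring₁ = solve-∀

-- With exponent `suc N`, (2i)^(N+1) is 2^(N+1) i modulo 2^(N+2) because powers preserve parity, and
-- the square of that power vanishes there. One more factor 2 comes from the sum of i C(k, 2i),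
-- which is k 2^(k-3), even from k = 4 on.
evens-divisible : ∀ k N → (+ 2) ^ (2 ℕ.+ N) ∣ evens (4 ℕ.+ k) (even-powers (suc N))
evens-divisible k N = subst ((+ 2) ^ (2 ℕ.+ N) ∣_) (sym expansion)
  (∣m∣n⇒∣m+n (∣m⇒∣-m (subst ((+ 2) ^ (2 ℕ.+ N) ∣_) (ℤ.*-comm (evens (4 ℕ.+ k) (+_)) p) (*-pres-2^∣ 1 (suc N) (subst (_∣ evens (4 ℕ.+ k) (+_)) (sym (ℤ.*-identityʳ (+ 2))) (2∣evens-id k)) ∣-refl)))
             (∣m⇒∣m*n _ ∣-refl))
  where
  p = (+ 2) ^ suc N
  q z : ℕ → ℤ
  q i = quotient (2∣x^n-x N i)
  z i = (+ 2) ^ N * (+ i) ^ (suc N ℕ.* 2) - q i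
  double-pow : ∀ n i → (+ (i ℕ.* 2)) ^ n ≡ (+ 2) ^ n * (+ i) ^ n
  double-pow n i = trans (cong (_^ n) (trans (pos-* i 2) (ℤ.*-comm (+ i) (+ 2)))) (^-distribʳ-* n (+ 2) (+ i))
  ring : ∀ a x i q → (+ 2 * a) * (+ 2 * a) * x - + 2 * a * (q * + 2 + i) ≡ - (+ 2 * a) * i + + 2 * (+ 2 * a) * (a * x - q)
  ring = solve-∀
  add-back : ∀ a b c → a - b ≡ c → a ≡ c + b
  add-back a b _ refl = ring′ a b
    where
    ring′ : ∀ a b → a ≡ a - b + b
    ring′ = solve-∀
  pointwise : ∀ i → even-powers (suc N) i ≡ - p * + i + (+ 2) ^ (2 ℕ.+ N) * z i
  pointwise i = begin
    (+ (i ℕ.* 2)) ^ (suc N ℕ.* 2) - (+ (i ℕ.* 2)) ^ suc N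
      ≡⟨ cong₂ _-_ (double-pow (suc N ℕ.* 2) i) (double-pow (suc N) i) ⟩
    (+ 2) ^ (suc N ℕ.* 2) * (+ i) ^ (suc N ℕ.* 2) - p * (+ i) ^ suc N
      ≡⟨ cong₂ (λ a b → a * (+ i) ^ (suc N ℕ.* 2) - p * b)
           (trans (cong ((+ 2) ^_) (double N)) (^-distribˡ-+-* (+ 2) (suc N) (suc N)))
           (add-back ((+ i) ^ suc N) (+ i) _ (_∣_.equality (2∣x^n-x N i))) ⟩
    p * p * (+ i) ^ (suc N ℕ.* 2) - p * (q i * + 2 + + i)
      ≡⟨ ring ((+ 2) ^ N) ((+ i) ^ (suc N ℕ.* 2)) (+ i) (q i) ⟩
    - p * + i + (+ 2) ^ (2 ℕ.+ N) * z i ∎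
    where
    double : ∀ N → suc N ℕ.* 2 ≡ suc N ℕ.+ suc N
    double = ℕ-Solver.solve-∀
  expansion : evens (4 ℕ.+ k) (even-powers (suc N)) ≡ - (p * evens (4 ℕ.+ k) (+_)) + (+ 2) ^ (2 ℕ.+ N) * evens (4 ℕ.+ k) z
  expansion = begin
    evens (4 ℕ.+ k) (even-powers (suc N))
      ≡⟨ evens-cong (4 ℕ.+ k) pointwise ⟩
    evens (4 ℕ.+ k) (λ i → - p * + i + (+ 2) ^ (2 ℕ.+ N) * z i)
      ≡⟨ evens-linear (4 ℕ.+ k) ((+ 2) ^ (2 ℕ.+ N)) (λ i → - p * + i) z ⟩
    evens (4 ℕ.+ k) (λ i → - p * + i) + (+ 2) ^ (2 ℕ.+ N) * evens (4 ℕ.+ k) z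
      ≡⟨ cong (_+ (+ 2) ^ (2 ℕ.+ N) * evens (4 ℕ.+ k) z) (trans (evens-* (4 ℕ.+ k) (- p) (+_)) (sym (ℤ.neg-distribˡ-* p _))) ⟩
    - (p * evens (4 ℕ.+ k) (+_)) + (+ 2) ^ (2 ℕ.+ N) * evens (4 ℕ.+ k) z ∎

-- Odd double factorials and the 2-part of (2^e - 1)!

dfact-odd : ∀ s → Odd (+ dfact s)
dfact-odd zero    = 0ℤ , refl
dfact-odd (suc s) = subst Odd (sym (pos-* (suc (s ℕ.* 2)) (dfact s))) (odd-* (odd-suc-double s) (dfact-odd s))

dfact-quotient : ∀ r s → ∃ λ o → Odd (+ o) × dfact (r ℕ.+ s) ≡ o ℕ.* dfact s
dfact-quotient zero    s = 1 , (0ℤ , refl) , sym (ℕ.*-identityˡ (dfact s))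
dfact-quotient (suc r) s with dfact-quotient r s
... | o , odd , eq = suc ((r ℕ.+ s) ℕ.* 2) ℕ.* o ,
  subst Odd (sym (pos-* (suc ((r ℕ.+ s) ℕ.* 2)) o)) (odd-* (odd-suc-double (r ℕ.+ s)) odd) ,
  trans (cong (suc ((r ℕ.+ s) ℕ.* 2) ℕ.*_) eq) (sym (ℕ.*-assoc (suc ((r ℕ.+ s) ℕ.* 2)) o (dfact s)))

suc[2^e∸1] : ∀ e → suc (2 ℕ.^ e ℕ.∸ 1) ≡ 2 ℕ.^ e
suc[2^e∸1] e = ℕ.m+[n∸m]≡n (ℕ.m^n>0 2 e)

2^[1+e]∸1 : ∀ e {H} → suc H ≡ 2 ℕ.^ e → 2 ℕ.^ suc e ℕ.∸ 1 ≡ suc (H ℕ.* 2)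
2^[1+e]∸1 e {H} eq = ℕ.suc-injective (trans (suc[2^e∸1] (suc e)) (trans (ℕ.*-comm 2 (2 ℕ.^ e)) (cong (ℕ._* 2) (sym eq))))

-- Legendre's value H - e for the valuation of H!, with e moved to the other side. The induction
-- uses (2H+1)! = 2^H H! `dfact (suc H)`.
!-valuation : ∀ e → let H = 2 ℕ.^ e ℕ.∸ 1 in
  ∃ λ o → Odd o × (+ 2) ^ suc e * + (H !) ≡ (+ 2) ^ suc H * o
!-valuation zero    = 1ℤ , (0ℤ , refl) , refl
!-valuation (suc e) with !-valuation e
... | o , odd , eq rewrite 2^[1+e]∸1 e (suc[2^e∸1] e) = + dfact (suc H) * o , odd-* (dfact-odd (suc H)) odd , (begin
    + 2 * (+ 2) ^ suc e * + (suc (H ℕ.* 2) !)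
      ≡⟨ cong (λ z → + 2 * (+ 2) ^ suc e * + z) (!-odd H) ⟩
    + 2 * (+ 2) ^ suc e * + (2 ℕ.^ H ℕ.* H ! ℕ.* dfact (suc H))
      ≡⟨ cong (+ 2 * (+ 2) ^ suc e *_) (trans (pos-* (2 ℕ.^ H ℕ.* H !) (dfact (suc H))) (cong (_* + dfact (suc H)) (trans (pos-* (2 ℕ.^ H) (H !)) (cong (_* + (H !)) (pos-2^ H))))) ⟩
    + 2 * (+ 2) ^ suc e * ((+ 2) ^ H * + (H !) * + dfact (suc H))
      ≡⟨ ring₁ ((+ 2) ^ suc e) ((+ 2) ^ H) (+ (H !)) (+ dfact (suc H)) ⟩
    + 2 * (+ 2) ^ H * + dfact (suc H) * ((+ 2) ^ suc e * + (H !))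
      ≡⟨ cong (+ 2 * (+ 2) ^ H * + dfact (suc H) *_) eq ⟩
    + 2 * (+ 2) ^ H * + dfact (suc H) * ((+ 2) ^ suc H * o)
      ≡⟨ ring₂ ((+ 2) ^ H) (+ dfact (suc H)) o ⟩
    + 2 * (+ 2 * ((+ 2) ^ H * (+ 2) ^ H)) * (+ dfact (suc H) * o)
      ≡⟨ cong (λ z → + 2 * (+ 2 * z) * (+ dfact (suc H) * o)) (trans (sym (^-distribˡ-+-* (+ 2) H H)) (cong ((+ 2) ^_) (double H))) ⟩
    (+ 2) ^ suc (suc (H ℕ.* 2)) * (+ dfact (suc H) * o) ∎)
  where
  H = 2 ℕ.^ e ℕ.∸ 1
  double : ∀ H → H ℕ.+ H ≡ H ℕ.* 2
  double = ℕ-Solver.solve-∀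
  ring₁ : ∀ a b f d → + 2 * a * (b * f * d) ≡ + 2 * b * d * (a * f)
  ring₁ = solve-∀
  ring₂ : ∀ b d o → + 2 * b * d * (+ 2 * b * o) ≡ + 2 * (+ 2 * (b * b)) * (d * o)
  ring₂ = solve-∀

-- The case m = 2

-- Lifting the exponent: squaring 1 + 2^e o with e ≥ 2 gives 1 + 2^(e+1) times an odd number. The
-- start is that odd powers of 9 are 9 modulo 16.
3^[c2^[1+n]] : ∀ q n → ∃ λ o → Odd o × (+ 3) ^ (suc (q ℕ.* 2) ℕ.* 2 ℕ.^ suc n) ≡ 1ℤ + (+ 2) ^ (3 ℕ.+ n) * o
3^[c2^[1+n]] q zero with 9^odd q
  where
  9^odd : ∀ q → ∃ λ o → Odd o × (+ 9) ^ suc (q ℕ.* 2) ≡ 1ℤ + + 8 * o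
  9^odd zero    = 1ℤ , (0ℤ , refl) , refl
  9^odd (suc q) with 9^odd q
  ... | _ , (p , refl) , eq = + 10 + + 81 * (1ℤ + + 2 * p) , (+ 45 + + 81 * p , ring₁ p) ,
    trans (cong (λ z → + 9 * (+ 9 * z)) eq) (ring₂ p)
    where
    ring₁ : ∀ p → + 10 + + 81 * (1ℤ + + 2 * p) ≡ 1ℤ + + 2 * (+ 45 + + 81 * p)
    ring₁ = solve-∀
    ring₂ : ∀ p → + 9 * (+ 9 * (1ℤ + + 8 * (1ℤ + + 2 * p))) ≡ 1ℤ + + 8 * (+ 10 + + 81 * (1ℤ + + 2 * p))
    ring₂ = solve-∀
... | o , odd , eq = o , odd , trans (cong ((+ 3) ^_) (ℕ.*-comm (suc (q ℕ.* 2)) 2)) (trans (sym (ℤ.^-*-assoc (+ 3) 2 (suc (q ℕ.* 2)))) eq)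
3^[c2^[1+n]] q (suc n) with 3^[c2^[1+n]] q n
... | _ , (p , refl) , eq = o + + 2 * (a * o * o) , (p + a * o * o , ring₁ p (a * o * o)) , (begin
  (+ 3) ^ (c ℕ.* (2 ℕ.* 2 ℕ.^ suc n))            ≡⟨ cong ((+ 3) ^_) (ring₂ c (2 ℕ.^ suc n)) ⟩
  (+ 3) ^ (c ℕ.* 2 ℕ.^ suc n ℕ.+ c ℕ.* 2 ℕ.^ suc n) ≡⟨ ^-distribˡ-+-* (+ 3) (c ℕ.* 2 ℕ.^ suc n) (c ℕ.* 2 ℕ.^ suc n) ⟩
  (+ 3) ^ (c ℕ.* 2 ℕ.^ suc n) * (+ 3) ^ (c ℕ.* 2 ℕ.^ suc n) ≡⟨ cong₂ _*_ eq eq ⟩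
  (1ℤ + + 2 * (+ 2 * a) * o) * (1ℤ + + 2 * (+ 2 * a) * o) ≡⟨ ring₃ a o ⟩
  1ℤ + + 2 * (+ 2 * (+ 2 * a)) * (o + + 2 * (a * o * o)) ∎)
  where
  c = suc (q ℕ.* 2)
  o = 1ℤ + + 2 * p
  a = (+ 2) ^ suc n
  ring₁ : ∀ p b → (1ℤ + + 2 * p) + + 2 * b ≡ 1ℤ + + 2 * (p + b)
  ring₁ = solve-∀
  ring₂ : ∀ c x → c ℕ.* (2 ℕ.* x) ≡ c ℕ.* x ℕ.+ c ℕ.* x
  ring₂ = ℕ-Solver.solve-∀
  ring₃ : ∀ a o → (1ℤ + + 2 * (+ 2 * a) * o) * (1ℤ + + 2 * (+ 2 * a) * o) ≡ 1ℤ + + 2 * (+ 2 * (+ 2 * a)) * (o + + 2 * (a * o * o))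
  ring₃ = solve-∀

6S-difference : ∀ N → + 6 * (+ S (suc N ℕ.* 2) 3 - + S (suc N) 3) ≡
  ((+ 3) ^ (suc N ℕ.* 2) - (+ 3) ^ suc N) - + 3 * ((+ 2) ^ (suc N ℕ.* 2) - (+ 2) ^ suc N)
6S-difference N = trans (Δ-powers (suc N) 3) (trans
  (cong₂ (λ x y → x3 - x2 - (x2 - (x - y)) - (x2 - (x - y) - (x - y - 0ℤ))) (ℤ.^-zeroˡ (suc N ℕ.* 2)) (ℤ.^-zeroˡ (suc N)))
  (ring x3 x2))
  where
  x3 = (+ 3) ^ (suc N ℕ.* 2) - (+ 3) ^ suc N
  x2 = (+ 2) ^ (suc N ℕ.* 2) - (+ 2) ^ suc N
  ring : ∀ a b → a - b - (b - 0ℤ) - (b - 0ℤ - 0ℤ) ≡ a - + 3 * b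
  ring = solve-∀

-- 6V is 3^N (3^N - 1) minus 3 * 2^N (2^N - 1). The first part has valuation n+3, and n+4 ≤ N pushes
-- the second beyond it.
valuation-3 : ∀ q n → let N = suc (q ℕ.* 2) ℕ.* 2 ℕ.^ suc n in
  n ℕ.+ 4 ℕ.≤ N → ν₂≡ (+ S (N ℕ.* 2) 3 - + S N 3) (2 ℕ.+ n)
valuation-3 q n n+4≤N with 3^[c2^[1+n]] q n
... | o , odd , eq = exact-valuation (2 ℕ.+ n) {+ 3} {3^N * o} {V} (1ℤ , refl) (odd-* odd-3^N odd)
  (divides (- (+ 3 * w * (2^N - 1ℤ))) (ℤ.*-cancelˡ-≡ (+ 2) _ _ (begin
    + 2 * (+ 3 * V - a * (3^N * o))
      ≡⟨ ring₁ V a 3^N o ⟩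
    + 6 * V - 3^N * (1ℤ + + 2 * a * o - 1ℤ)
      ≡⟨ cong₂ (λ x y → x - 3^N * (y - 1ℤ)) 6V (sym eq) ⟩
    (3^N * 3^N - 3^N) - + 3 * (2^N * 2^N - 2^N) - 3^N * (3^N - 1ℤ)
      ≡⟨ ring₂ 3^N 2^N ⟩
    - (+ 3 * 2^N * (2^N - 1ℤ))
      ≡⟨ cong (λ z → - (+ 3 * z * (2^N - 1ℤ))) 2^N≡ ⟩
    - (+ 3 * (w * (+ 2 * (+ 2 * a))) * (2^N - 1ℤ))
      ≡⟨ ring₃ w a (2^N - 1ℤ) ⟩
    + 2 * (- (+ 3 * w * (2^N - 1ℤ)) * (+ 2 * a)) ∎)))
  where
  N = suc (q ℕ.* 2) ℕ.* 2 ℕ.^ suc n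
  V = + S (N ℕ.* 2) 3 - + S N 3
  3^N = (+ 3) ^ N
  2^N = (+ 2) ^ N
  a = (+ 2) ^ (2 ℕ.+ n)
  4a∣ : (+ 2) ^ (4 ℕ.+ n) ∣ 2^N
  4a∣ = 2^-mono-∣ (subst (ℕ._≤ N) (ℕ.+-comm n 4) n+4≤N)
  w = quotient 4a∣
  2^N≡ = _∣_.equality 4a∣
  odd-3^N : Odd 3^N
  odd-3^N = a * o , trans eq (cong (_+_ 1ℤ) (ℤ.*-assoc (+ 2) a o))
  6V : + 6 * V ≡ (3^N * 3^N - 3^N) - + 3 * (2^N * 2^N - 2^N)
  6V = trans (subst (λ M → + 6 * (+ S (M ℕ.* 2) 3 - + S M 3) ≡ ((+ 3) ^ (M ℕ.* 2) - (+ 3) ^ M) - + 3 * ((+ 2) ^ (M ℕ.* 2) - (+ 2) ^ M))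
      (ℕ.suc-pred N {{ℕ.m*n≢0 (suc (q ℕ.* 2)) (2 ℕ.^ suc n) {{_}} {{ℕ.m^n≢0 2 (suc n)}}}}) (6S-difference (ℕ.pred N)))
    (cong₂ (λ x y → (x - 3^N) - + 3 * (y - 2^N)) (square (+ 3)) (square (+ 2)))
    where
    square : ∀ x → x ^ (N ℕ.* 2) ≡ x ^ N * x ^ N
    square x = trans (cong (x ^_) (double N)) (^-distribˡ-+-* x N N)
      where
      double : ∀ N → N ℕ.* 2 ≡ N ℕ.+ N
      double = ℕ-Solver.solve-∀
  ring₁ : ∀ V a t o → + 2 * (+ 3 * V - a * (t * o)) ≡ + 6 * V - t * (1ℤ + + 2 * a * o - 1ℤ)
  ring₁ = solve-∀
  ring₂ : ∀ t u → (t * t - t) - + 3 * (u * u - u) - t * (t - 1ℤ) ≡ - (+ 3 * u * (u - 1ℤ))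
  ring₂ = solve-∀
  ring₃ : ∀ w a v → - (+ 3 * (w * (+ 2 * (+ 2 * a))) * v) ≡ + 2 * (- (+ 3 * w * v) * (+ 2 * a))
  ring₃ = solve-∀

-- The case m ≥ 3

module _ (M n c N₁ : ℕ) (1≤M : 1 ℕ.≤ M) (m≤n : suc (suc M) ℕ.≤ n) (N≡ : suc N₁ ≡ 2 ℕ.^ n ℕ.* c) (odd-c : Odd (+ c)) where

  private
    N = suc N₁
    -- In this module m = M+2, so `g` is h/2, `H` is h-1, and `s₀` is H - g.
    g = 2 ℕ.^ M
    s₀ = g ℕ.∸ 1
    H = 2 ℕ.^ suc M ℕ.∸ 1
    k = suc (H ℕ.* 2)
    V = + S (N ℕ.* 2) k - + S N k
    E = evens k (even-powers N)

    h≡ : suc H ≡ 2 ℕ.^ suc M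
    h≡ = suc[2^e∸1] (suc M)

    s₀≡ : suc s₀ ≡ g
    s₀≡ = suc[2^e∸1] M

    H≡ : H ≡ g ℕ.+ s₀
    H≡ = ℕ.suc-injective (trans h≡ (trans (cong (λ z → g ℕ.+ z) (trans (ℕ.+-identityʳ g) (sym s₀≡))) (ℕ.+-suc g s₀)))

    c≥1 : 1 ℕ.≤ c
    c≥1 = ℕ.n≢0⇒n>0 λ { refl → ℕ.1+n≢0 (trans N≡ (ℕ.*-zeroʳ (2 ℕ.^ n))) }

    2^n≤N : 2 ℕ.^ n ℕ.≤ N
    2^n≤N = subst (2 ℕ.^ n ℕ.≤_) (sym N≡) (ℕ.m≤m*n (2 ℕ.^ n) c {{ℕ.>-nonZero c≥1}})

    H<N : H ℕ.< N
    H<N = subst (ℕ._≤ N) (sym h≡) (ℕ.≤-trans (ℕ.^-monoʳ-≤ 2 (ℕ.≤-trans (ℕ.n≤1+n (suc M)) m≤n)) 2^n≤N)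

    2^n∣N : (+ 2) ^ n ∣ + N
    2^n∣N = divides (+ c) (trans (cong +_ N≡) (trans (pos-* (2 ℕ.^ n) c) (trans (cong (_* + c) (pos-2^ n)) (ℤ.*-comm _ (+ c)))))

    κ o : ℕ → ℤ
    κ r = + ((H ℕ.+ (H ℕ.∸ r)) C H)
    o r = + proj₁ (dfact-quotient r (H ℕ.∸ r))

    odd-o : ∀ r → Odd (o r)
    odd-o r = proj₁ (proj₂ (dfact-quotient r (H ℕ.∸ r)))

    -- The double sum of the overview with its odd factors `o r` made explicit; it will be congruent
    -- to `W * d₁ * V`.
    X : ℤ
    X = Σ< (suc H) (λ r → o r * (κ r * Y N r))

    main : ℤ
    main = o g * (κ g * ((1ℤ - + g * + g) * D N g))

    g-even : ∃ λ x → g ≡ x ℕ.* 2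
    g-even = even 1≤M
      where
      even : ∀ {M} → 1 ℕ.≤ M → ∃ λ x → 2 ℕ.^ M ≡ x ℕ.* 2
      even {suc M} _ = 2 ℕ.^ M , ℕ.*-comm 2 (2 ℕ.^ M)

    κ-divisible : ∀ r → r ℕ.≤ H → (+ 2) ^ suc M ∣ + suc r * κ r
    κ-divisible r r≤H = subst (λ z → (+ 2) ^ suc M ∣ + suc r * + ((z ℕ.+ (H ℕ.∸ r)) C z)) (ℕ.m+[n∸m]≡n r≤H)
      (coefficient-divisible (suc M) r (H ℕ.∸ r) (trans (cong suc (ℕ.m+[n∸m]≡n r≤H)) h≡))

    2≤n : 2 ℕ.≤ n
    2≤n = ℕ.≤-trans (s≤s (s≤s z≤n)) m≤n

    congruence : ∀ r → r ℕ.≤ H → (+ 2) ^ (n ℕ.+ 2) ∣ κ r * Y N r - κ r * ((1ℤ - + r * + r) * D N r)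
    congruence r r≤H = term-congruence (suc M) n N r (κ r) (s≤s 1≤M) 2≤n
      (subst (r ℕ.<_) h≡ (s≤s r≤H)) (ℕ.≤-<-trans r≤H H<N) 2^n∣N (κ-divisible r r≤H)

    leading : ∀ r → r ℕ.≤ H → ¬ r ≡ g → (+ 2) ^ (n ℕ.+ 2) ∣ κ r * ((1ℤ - + r * + r) * D N r)
    leading r r≤H r≢g with parity r
    ... | q , inj₁ refl = leading-even M n N (q ℕ.* 2) (κ (q ℕ.* 2)) (subst (q ℕ.* 2 ℕ.<_) h≡ (s≤s r≤H)) r≢g (odd-suc-double q) 2^n∣N (κ-divisible (q ℕ.* 2) r≤H)
    ... | q , inj₂ refl = leading-odd n N (suc (q ℕ.* 2)) (κ (suc (q ℕ.* 2))) (odd-suc-double q) 2^n∣N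

    ∣-combine : ∀ {d} a b → d ∣ a - b → d ∣ b → d ∣ a
    ∣-combine a b p q = ∣m+n∣n⇒∣m p (∣m⇒∣-m q)

    g≤H : g ℕ.≤ H
    g≤H = subst (g ℕ.≤_) (sym H≡) (ℕ.m≤m+n g s₀)

    X≡main : (+ 2) ^ (n ℕ.+ 2) ∣ X - main
    X≡main = subst ((+ 2) ^ (n ℕ.+ 2) ∣_) (ring X (o g) (κ g * Y N g) (κ g * ((1ℤ - + g * + g) * D N g)))
      (∣m∣n⇒∣m+n
        (Σ<-single (suc H) g (λ r → o r * (κ r * Y N r)) (s≤s g≤H) λ r r<h r≢g →
          ∣n⇒∣m*n (o r) (∣-combine (κ r * Y N r) _ (congruence r (ℕ.≤-pred r<h)) (leading r (ℕ.≤-pred r<h) r≢g)))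
        (∣n⇒∣m*n (o g) (congruence g g≤H)))
      where
      ring : ∀ X o a b → X - o * a + o * (a - b) ≡ X - o * b
      ring = solve-∀

    -- `dfact H` is a common multiple of the odd denominators `dfact (H ∸ r)`, with odd quotients
    -- `o r`, so one multiplier serves all r.
    coefficient : ∀ r → r ℕ.≤ H → + dfact H * (+ A k r * ((+ 2) ^ r * + (r !) * Y N r)) ≡
      (+ 2) ^ H * + (H !) * (o r * (κ r * Y N r))
    coefficient r r≤H = begin
      + dfact H * (+ A k r * ((+ 2) ^ r * + (r !) * Y N r))
        ≡⟨ cong (_* (+ A k r * ((+ 2) ^ r * + (r !) * Y N r))) (trans (cong +_ dfact-H) (pos-* o′ (dfact s))) ⟩
      o r * + dfact s * (+ A k r * ((+ 2) ^ r * + (r !) * Y N r))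
        ≡⟨ ring₁ (o r) (+ dfact s) (+ A k r) ((+ 2) ^ r) (+ (r !)) (Y N r) ⟩
      (+ 2) ^ r * + (r !) * + A k r * + dfact s * (o r * Y N r)
        ≡⟨ cong (_* (o r * Y N r)) A-dfact-ℤ ⟩
      (+ 2) ^ H * + (H !) * κ r * (o r * Y N r)
        ≡⟨ ring₂ ((+ 2) ^ H * + (H !)) (κ r) (o r) (Y N r) ⟩
      (+ 2) ^ H * + (H !) * (o r * (κ r * Y N r)) ∎
      where
      s = H ℕ.∸ r
      o′ = proj₁ (dfact-quotient r s)
      r+s≡H : r ℕ.+ s ≡ H
      r+s≡H = ℕ.m+[n∸m]≡n r≤H
      dfact-H : dfact H ≡ o′ ℕ.* dfact s
      dfact-H = trans (cong dfact (sym r+s≡H)) (proj₂ (proj₂ (dfact-quotient r s)))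
      ring₁ : ∀ o d a p f y → o * d * (a * (p * f * y)) ≡ p * f * a * d * (o * y)
      ring₁ = solve-∀
      ring₂ : ∀ b κ o y → b * κ * (o * y) ≡ b * (o * (κ * y))
      ring₂ = solve-∀
      A-dfact-ℤ : (+ 2) ^ r * + (r !) * + A k r * + dfact s ≡ (+ 2) ^ H * + (H !) * κ r
      A-dfact-ℤ = begin
        (+ 2) ^ r * + (r !) * + A k r * + dfact s
          ≡⟨ cong (λ z → z * + (r !) * + A k r * + dfact s) (pos-2^ r) ⟨
        + (2 ℕ.^ r) * + (r !) * + A k r * + dfact s
          ≡⟨ trans (pos-* (2 ℕ.^ r ℕ.* r ! ℕ.* A k r) (dfact s)) (cong (_* + dfact s) (trans (pos-* (2 ℕ.^ r ℕ.* r !) (A k r)) (cong (_* + A k r) (pos-* (2 ℕ.^ r) (r !))))) ⟨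
        + (2 ℕ.^ r ℕ.* r ! ℕ.* A k r ℕ.* dfact s)
          ≡⟨ cong +_ (subst (λ z → 2 ℕ.^ r ℕ.* r ! ℕ.* A (suc (z ℕ.* 2)) r ℕ.* dfact s ≡ 2 ℕ.^ z ℕ.* z ! ℕ.* ((z ℕ.+ s) C z)) r+s≡H (A-dfact r s)) ⟩
        + (2 ℕ.^ H ℕ.* H ! ℕ.* ((H ℕ.+ s) C H))
          ≡⟨ trans (pos-* (2 ℕ.^ H ℕ.* H !) ((H ℕ.+ s) C H)) (cong (_* κ r) (pos-* (2 ℕ.^ H) (H !))) ⟩
        + (2 ℕ.^ H) * + (H !) * κ r
          ≡⟨ cong (λ z → z * + (H !) * κ r) (pos-2^ H) ⟩
        (+ 2) ^ H * + (H !) * κ r ∎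

    W d₁ : ℤ
    W = + dfact H
    d₁ = + dfact (suc H)

    k!≡ : + (k !) ≡ (+ 2) ^ H * + (H !) * d₁
    k!≡ = trans (cong +_ (!-odd H)) (trans (pos-* (2 ℕ.^ H ℕ.* H !) (dfact (suc H)))
      (cong (_* d₁) (trans (pos-* (2 ℕ.^ H) (H !)) (cong (_* + (H !)) (pos-2^ H)))))

    Z-term X-term : ℕ → ℤ
    Z-term r = + A k r * ((+ 2) ^ r * + (r !) * Y N r)
    X-term r = o r * (κ r * Y N r)

    W-sum : W * Σ< (suc H) Z-term ≡ (+ 2) ^ H * + (H !) * X
    W-sum = begin
      W * Σ< (suc H) Z-term
        ≡⟨ Σ<-* (suc H) W Z-term ⟨
      Σ< (suc H) (λ r → W * Z-term r)
        ≡⟨ Σ<-cong-< (suc H) (λ r r<h → coefficient r (ℕ.≤-pred r<h)) ⟩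
      Σ< (suc H) (λ r → (+ 2) ^ H * + (H !) * X-term r)
        ≡⟨ Σ<-* (suc H) ((+ 2) ^ H * + (H !)) X-term ⟩
      (+ 2) ^ H * + (H !) * X ∎

    -- As k! = 2^H H! `d₁`, the multiplier `W * d₁` makes the odd points contribute exactly k! `X`;
    -- the even points are the whole error.
    k!-identity : + (k !) * (W * d₁ * V - X) ≡ - (d₁ * W) * E
    k!-identity = begin
      + (k !) * (W * d₁ * V - X)
        ≡⟨ ring₁ (+ (k !)) W d₁ V X ⟩
      d₁ * (W * (+ (k !) * V)) - + (k !) * X
        ≡⟨ cong₂ (λ y z → d₁ * (W * y) - z * X) (S-difference H N (ℕ.<⇒≤ H<N)) k!≡ ⟩
      d₁ * (W * (Z - E)) - (+ 2) ^ H * + (H !) * d₁ * X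
        ≡⟨ ring₂ d₁ W Z E ((+ 2) ^ H * + (H !)) X ⟩
      d₁ * (W * Z - (+ 2) ^ H * + (H !) * X) + - (d₁ * W) * E
        ≡⟨ cong (λ y → d₁ * (y - (+ 2) ^ H * + (H !) * X) + - (d₁ * W) * E) W-sum ⟩
      d₁ * ((+ 2) ^ H * + (H !) * X - (+ 2) ^ H * + (H !) * X) + - (d₁ * W) * E
        ≡⟨ ring₃ d₁ ((+ 2) ^ H * + (H !) * X) (- (d₁ * W) * E) ⟩
      - (d₁ * W) * E ∎
      where
      Z = Σ< (suc H) Z-term
      ring₁ : ∀ f W d V X → f * (W * d * V - X) ≡ d * (W * (f * V)) - f * X
      ring₁ = solve-∀
      ring₂ : ∀ d W Z E b X → d * (W * (Z - E)) - b * d * X ≡ d * (W * Z - b * X) + - (d * W) * E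
      ring₂ = solve-∀
      ring₃ : ∀ d b e → d * (b - b) + e ≡ e
      ring₃ = solve-∀

    k≡ : 2 ℕ.^ suc (suc M) ℕ.∸ 1 ≡ k
    k≡ = 2^[1+e]∸1 (suc M) h≡

    2^sum : ∀ m j → 2 ℕ.^ m ℕ.+ j ℕ.≤ 2 ℕ.^ (m ℕ.+ j)
    2^sum m zero    = ℕ.≤-reflexive (trans (ℕ.+-identityʳ _) (cong (2 ℕ.^_) (sym (ℕ.+-identityʳ m))))
    2^sum m (suc j) = subst₂ ℕ._≤_ (trans (ℕ.+-assoc (2 ℕ.^ m) j 1) (cong (2 ℕ.^ m ℕ.+_) (ℕ.+-comm j 1))) (trans (double (2 ℕ.^ (m ℕ.+ j))) (cong (2 ℕ.^_) (sym (ℕ.+-suc m j))))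
      (ℕ.+-mono-≤ (2^sum m j) (ℕ.m^n>0 2 (m ℕ.+ j)))
      where
      double : ∀ x → x ℕ.+ x ≡ 2 ℕ.* x
      double = ℕ-Solver.solve-∀

    -- Amounts to 2^m + (n-m) ≤ N. For n = m and c = 1 this is an equality, so the additional factor
    -- 2 in `E` is indispensable.
    exponents : suc k ℕ.+ (n ℕ.+ 2) ℕ.≤ suc (suc (suc M)) ℕ.+ suc N
    exponents = subst₂ ℕ._≤_ (ring₁ (suc k) (n ℕ.∸ m) m n (ℕ.m∸n+n≡m m≤n)) (ring₂ m N)
      (ℕ.+-monoˡ-≤ (m ℕ.+ 2) (subst (λ z → z ℕ.+ (n ℕ.∸ m) ℕ.≤ N) (trans (sym (suc[2^e∸1] m)) (cong suc k≡))
        (ℕ.≤-trans (2^sum m (n ℕ.∸ m)) (subst (λ z → 2 ℕ.^ z ℕ.≤ N) (sym (ℕ.m+[n∸m]≡n m≤n)) 2^n≤N))))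
      where
      m = suc (suc M)
      ring₁ : ∀ k j m n → j ℕ.+ m ≡ n → k ℕ.+ j ℕ.+ (m ℕ.+ 2) ≡ k ℕ.+ (n ℕ.+ 2)
      ring₁ k j m _ refl = ring k j m
        where
        ring : ∀ k j m → k ℕ.+ j ℕ.+ (m ℕ.+ 2) ≡ k ℕ.+ (j ℕ.+ m ℕ.+ 2)
        ring = ℕ-Solver.solve-∀
      ring₂ : ∀ m N → N ℕ.+ (m ℕ.+ 2) ≡ suc m ℕ.+ suc N
      ring₂ = ℕ-Solver.solve-∀

    E-divisible : (+ 2) ^ suc N ∣ E
    E-divisible = subst (λ z → (+ 2) ^ suc N ∣ evens z (even-powers N)) (ℕ.m+[n∸m]≡n 4≤k) (evens-divisible (k ℕ.∸ 4) N₁)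
      where
      3≤H : 3 ℕ.≤ H
      3≤H = ℕ.≤-pred (subst (4 ℕ.≤_) (sym h≡) (ℕ.^-monoʳ-≤ 2 (s≤s 1≤M)))
      4≤k : 4 ℕ.≤ k
      4≤k = s≤s (ℕ.≤-trans 3≤H (ℕ.m≤m*n H 2))

    -- Only the 2-part of k! has to be cancelled. The factor 2^(m+1) on both sides turns k! into
    -- 2^(k+1) times an odd number.
    WdV≡X : (+ 2) ^ (n ℕ.+ 2) ∣ W * d₁ * V - X
    WdV≡X with subst (λ z → ∃ λ u → Odd u × (+ 2) ^ suc (suc (suc M)) * + (z !) ≡ (+ 2) ^ suc z * u) k≡ (!-valuation (suc (suc M)))
    ... | u , odd-u , k!2-part = strip (suc k) (suc (suc (suc M)) ℕ.+ suc N) (n ℕ.+ 2) odd-u exponents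
      (subst ((+ 2) ^ (suc (suc (suc M)) ℕ.+ suc N) ∣_) rearranged
        (*-pres-2^∣ (suc (suc (suc M))) (suc N) ∣-refl (∣n⇒∣m*n (- (d₁ * W)) E-divisible)))
      where
      p = (+ 2) ^ suc (suc (suc M))
      rearranged : p * (- (d₁ * W) * E) ≡ (+ 2) ^ suc k * u * (W * d₁ * V - X)
      rearranged = trans (cong (p *_) (sym k!-identity)) (trans (sym (ℤ.*-assoc p (+ (k !)) _)) (cong (_* (W * d₁ * V - X)) k!2-part))

    odd-1-g² : Odd (1ℤ - + g * + g)
    odd-1-g² with g-even
    ... | x , eq = - (+ 2 * + x * + x) , trans (cong (λ z → 1ℤ - z * z) (trans (cong +_ eq) (pos-* x 2))) (ring (+ x))
      where
      ring : ∀ x → 1ℤ - x * + 2 * (x * + 2) ≡ 1ℤ + + 2 * (- (+ 2 * x * x))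
      ring = solve-∀

    main-exact : ∃₂ λ w Q → Odd w × Odd Q × w * (κ g * D N g) ≡ (+ 2) ^ suc n * Q
    main-exact = subst (λ z → ∃₂ λ w Q → Odd w × Odd Q × w * (z * D N g) ≡ (+ 2) ^ suc n * Q) κ≡
      (subst (λ z → ∃₂ λ w Q → Odd w × Odd Q × w * (+ ((z ℕ.+ s₀ ℕ.+ s₀) C (z ℕ.+ s₀)) * D N z) ≡ (+ 2) ^ suc n * Q) s₀≡
        (main-term M n c s₀ N₁ 1≤M (ℕ.≤-trans (ℕ.n≤1+n M) (ℕ.≤-trans (ℕ.n≤1+n (suc M)) m≤n)) s₀≡ N≡ odd-c))
      where
      κ≡ : + ((g ℕ.+ s₀ ℕ.+ s₀) C (g ℕ.+ s₀)) ≡ κ g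
      κ≡ = cong₂ (λ y z → + ((y ℕ.+ z) C y)) (sym H≡) (sym (trans (cong (ℕ._∸ g) H≡) (ℕ.m+n∸m≡n g s₀)))

  valuation-large : ν₂≡ (+ S (suc N₁ ℕ.* 2) (2 ℕ.^ suc (suc M) ℕ.∸ 1) - + S (suc N₁) (2 ℕ.^ suc (suc M) ℕ.∸ 1)) (suc n)
  valuation-large with main-exact
  ... | w , Q , odd-w , odd-Q , eq = subst (λ z → ν₂≡ (+ S (N ℕ.* 2) z - + S N z) (suc n)) (sym k≡)
    (exact-valuation (suc n) {w * (W * d₁)} {o g * (1ℤ - + g * + g) * Q} {V}
      (odd-* odd-w (odd-* (dfact-odd H) (dfact-odd (suc H)))) (odd-* (odd-* (odd-o g) odd-1-g²) odd-Q)
      (subst₂ (λ e z → (+ 2) ^ e ∣ z) (ℕ.+-comm n 2) difference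
        (∣n⇒∣m*n w (∣m∣n⇒∣m+n WdV≡X X≡main))))
    where
    f = 1ℤ - + g * + g
    ring₁ : ∀ w W d V X o κ f D → w * (W * d * V - X + (X - o * (κ * (f * D)))) ≡ w * (W * d) * V - o * f * (w * (κ * D))
    ring₁ = solve-∀
    ring₂ : ∀ o f p Q → o * f * (p * Q) ≡ p * (o * f * Q)
    ring₂ = solve-∀
    difference : w * (W * d₁ * V - X + (X - main)) ≡ w * (W * d₁) * V - (+ 2) ^ suc n * (o g * f * Q)
    difference = trans (ring₁ w W d₁ V X (o g) (κ g) f (D N g))
      (cong (λ z → w * (W * d₁) * V - z) (trans (cong (o g * f *_) eq) (ring₂ (o g) f ((+ 2) ^ suc n) Q)))

-- The exceptional triple and the conclusion

-- With n = 2+j and c = 2q+1 this is n+3 ≤ c 2^n; at n = 2, c = 1 it would read 5 ≤ 4, the origin of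
-- the exception.
c2^n-large : ∀ q j → ¬ (j ≡ 0 × q ≡ 0) → suc j ℕ.+ 4 ℕ.≤ suc (q ℕ.* 2) ℕ.* 2 ℕ.^ (2 ℕ.+ j)
c2^n-large zero    zero    ne = ⊥-elim (ne (refl , refl))
c2^n-large (suc q) zero    _  = ℕ.≤-trans (ℕ.m≤m+n 5 7) (ℕ.*-monoˡ-≤ 4 {3} (ℕ.m≤m+n 3 (q ℕ.* 2)))
c2^n-large q       (suc j) _  = ℕ.≤-trans
  (subst₂ ℕ._≤_ (ℕ.+-comm 4 (2 ℕ.+ j)) (ring j) (ℕ.m≤m+n (6 ℕ.+ j) (2 ℕ.+ 7 ℕ.* j)))
  (ℕ.≤-trans (subst (8 ℕ.* suc j ℕ.≤_) (sym (ℕ.^-distribˡ-+-* 2 3 j)) (ℕ.*-monoʳ-≤ 8 (n<2^n j)))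
    (ℕ.m≤n*m (2 ℕ.^ (3 ℕ.+ j)) (suc (q ℕ.* 2))))
  where
  ring : ∀ j → 6 ℕ.+ j ℕ.+ (2 ℕ.+ 7 ℕ.* j) ≡ 8 ℕ.* suc j
  ring = ℕ-Solver.solve-∀

theorem1p3 : (c m n : ℕ) → 1 ℕ.≤ c → 2 ℕ∣.∤ c → 2 ℕ.≤ m → m ℕ.≤ n →
    (¬ (n ≡ 2 × m ≡ 2 × c ≡ 1) →
    ν₂≡ (+ S (c ℕ.* 2 ℕ.^ suc n) (2 ℕ.^ m ℕ.∸ 1) - + S (c ℕ.* 2 ℕ.^ n) (2 ℕ.^ m ℕ.∸ 1)) (suc n))
    × ((n ≡ 2 × m ≡ 2 × c ≡ 1) →
    ν₂≡ (+ S 8 3 - + S 4 3) 6)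
theorem1p3 c m n 1≤c 2∤c 2≤m m≤n = general m n (parity c) 2∤c 2≤m m≤n , λ _ →
  -- S(8,3) - S(4,3) = 966 - 6 = 960 = 15 * 64.
  ℕ∣.divides 15 refl , toWitnessFalse {a? = 128 ℕ∣.∣? 960} _
  where
  difference : ℕ → ℕ → ℕ → ℤ
  difference k x y = + S x (2 ℕ.^ k ℕ.∸ 1) - + S y (2 ℕ.^ k ℕ.∸ 1)
  2N≡ : ∀ c n → c ℕ.* 2 ℕ.^ n ℕ.* 2 ≡ c ℕ.* 2 ℕ.^ suc n
  2N≡ c n = trans (ℕ.*-assoc c (2 ℕ.^ n) 2) (cong (c ℕ.*_) (ℕ.*-comm (2 ℕ.^ n) 2))
  general : ∀ {c} m n → (∃ λ q → c ≡ q ℕ.* 2 ⊎ c ≡ suc (q ℕ.* 2)) → 2 ℕ∣.∤ c → 2 ℕ.≤ m → m ℕ.≤ n →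
    ¬ (n ≡ 2 × m ≡ 2 × c ≡ 1) → ν₂≡ (difference m (c ℕ.* 2 ℕ.^ suc n) (c ℕ.* 2 ℕ.^ n)) (suc n)
  general m n (q , inj₁ refl) 2∤c _ _ _ = ⊥-elim (2∤c (ℕ∣.divides q refl))
  general 1 _ _ _ (s≤s ()) _ _
  general 2 1 _ _ _ (s≤s ()) _
  general 2 (suc (suc j)) (q , inj₂ refl) _ _ _ ne =
    subst (λ x → ν₂≡ (difference 2 x (c′ ℕ.* 2 ℕ.^ (2 ℕ.+ j))) (3 ℕ.+ j)) (2N≡ c′ (2 ℕ.+ j))
      (valuation-3 q (suc j) (c2^n-large q j λ { (refl , refl) → ne (refl , refl , refl) }))
    where
    c′ = suc (q ℕ.* 2)
  general (suc (suc (suc M))) n (q , inj₂ refl) _ _ m≤n _ =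
    subst₂ (λ x y → ν₂≡ (difference (3 ℕ.+ M) x y) (suc n)) (trans (cong (ℕ._* 2) N≡) (2N≡ c′ n)) N≡
      (valuation-large (suc M) n c′ (ℕ.pred (c′ ℕ.* 2 ℕ.^ n)) (s≤s z≤n) m≤n (trans N≡ (ℕ.*-comm c′ (2 ℕ.^ n))) (odd-suc-double q))
    where
    c′ = suc (q ℕ.* 2)
    N≡ = ℕ.suc-pred (c′ ℕ.* 2 ℕ.^ n) {{ℕ.m*n≢0 c′ (2 ℕ.^ n) {{_}} {{ℕ.m^n≢0 2 n}}}}
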